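{- Let $\mathcal{F}$ be a class of graphs. The following statements are equivalent: (i) there is a constant $C_\mathcal{F}$ such that every $G\in\mathcal{F}$ and every neighborhood system $\Sigma$ for $G$ satisfy $\mathrm{mad}(\Sigma)\le C_\mathcal{F}\cdot\rho(\Sigma)$; (ii) there is a function $f_\mathcal{F}$ such that every $G\in\mathcal{F}$ and every neighborhood system $\Sigma$ for $G$ satisfy $\mathrm{mad}(\Sigma)\le f_\mathcal{F}(\rho(\Sigma))$; (iii) the supremum of $\mathrm{mad}(\Sigma)$ over all $G\in\mathcal{F}$ and all neighborhood systems $\Sigma$ for $G$ with $\rho(\Sigma)=2$ is finite; (iv) $\mathcal{F}$ has bounded arrangeability, i.e. there is a constant $k$ such that every graph in $\mathcal{F}$ has arrangeability at most $k$.
   Context: Graphs are finite and simple. For a graph $G=(V,E)$, a neighborhood system for $G$ is a collection $(\Sigma(v))_{v\in V}$ with $\Sigma(v)\subseteq N(v)$ (the set of neighbors of $v$), and $\rho(\Sigma)=\max_v|\Sigma(v)|$. $G_\Sigma$ is the graph on vertex set $V$ in which distinct $u,v$ are adjacent iff there is $w$ with $\{u,v\}\subseteq\Sigma(w)$. $\mathrm{mad}(\Sigma)$ is the maximum average degree of a subgraph of $G_\Sigma$ (maximum of $2|E(H)|/|V(H)|$ over nonempty subgraphs $H$). The arrangeability of $G$ is the least $k$ such that there is a linear ordering $\prec$ of $V(G)$ such that for every vertex $v$, there are at most $k$ vertices $u\prec v$ for which there exists a common neighbor $w$ of $u$ and $v$ with $v\prec w$. -}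

module Defs where

open import Data.Nat as ℕ using (ℕ; zero; suc; _+_; _<ᵇ_)
open import Data.Bool using (Bool; true; false; if_then_else_; _∧_; _∨_; not)
open import Data.Fin using (Fin; zero; suc; toℕ; _≟_)
open import Data.Fin.Subset using (Subset; _∈_; _⊆_; ∣_∣; Nonempty)
open import Data.Fin.Permutation using (Permutation′; _⟨$⟩ʳ_)
open import Data.Vec using (lookup)
open import Data.Product using (Σ; _×_; ∃)
open import Data.Integer using (+_)
open import Data.Rational using (ℚ; _/_; _*_; _≤_)
open import Relation.Binary.PropositionalEquality using (_≡_)
open import Relation.Nullary using (¬_)
open import Relation.Nullary.Decidable using (⌊_⌋)

record Graph (n : ℕ) : Set where
  field
    adj   : Fin n → Fin n → Bool
    sym   : ∀ u v → adj u v ≡ adj v u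
    irrefl : ∀ v → adj v v ≡ false
open Graph public

N : ∀ {n} → Graph n → Fin n → Subset n
N G v = Data.Vec.tabulate (λ u → adj G v u)

record NeighborhoodSystem {n : ℕ} (G : Graph n) : Set where
  field
    sys : Fin n → Subset n
    sub : ∀ v → sys v ⊆ N G v
open NeighborhoodSystem public

count : ∀ {n} → (Fin n → Bool) → ℕ
count {zero}  p = 0
count {suc n} p = (if p zero then 1 else 0) + count (λ i → p (suc i))

anyB : ∀ {n} → (Fin n → Bool) → Bool
anyB {zero}  p = false
anyB {suc n} p = p zero ∨ anyB (λ i → p (suc i))

maxF : ∀ {n} → (Fin n → ℕ) → ℕ
maxF {zero}  f = 0
maxF {suc n} f = f zero ℕ.⊔ maxF (λ i → f (suc i))

ρ : ∀ {n} {G : Graph n} → NeighborhoodSystem G → ℕ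
ρ Sg = maxF (λ v → ∣ sys Sg v ∣)

adjΣ : ∀ {n} {G : Graph n} → NeighborhoodSystem G → Fin n → Fin n → Bool
adjΣ Sg u v = not ⌊ u ≟ v ⌋ ∧ anyB (λ w → lookup (sys Sg w) u ∧ lookup (sys Sg w) v)

sumF : ∀ {n} → (Fin n → ℕ) → ℕ
sumF {zero}  f = 0
sumF {suc n} f = f zero + sumF (λ i → f (suc i))

edgeCount : ∀ {n} → (Fin n → Fin n → Bool) → ℕ
edgeCount F = sumF (λ u → count (λ v → (toℕ u <ᵇ toℕ v) ∧ F u v))

toℚ : ℕ → ℚ
toℚ m = (+ m) / 1

record Subgraph {n : ℕ} {G : Graph n} (Sg : NeighborhoodSystem G) : Set where
  field
    S      : Subset n
    nonemp : Nonempty S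
    F      : Fin n → Fin n → Bool
    Fsym   : ∀ u v → F u v ≡ F v u
    Fsub   : ∀ u v → F u v ≡ true → (u ∈ S) × (v ∈ S) × (adjΣ Sg u v ≡ true)
open Subgraph public

-- mad(Σ) ≤ x : every nonempty subgraph H of G_Σ has 2|E(H)|/|V(H)| ≤ x
-- (written as 2|E(H)| ≤ x·|V(H)|, |V(H)| > 0).
madAtMost : ∀ {n} {G : Graph n} → NeighborhoodSystem G → ℚ → Set
madAtMost Sg x = (H : Subgraph Sg) → toℚ (2 ℕ.* edgeCount (F H)) ≤ x * toℚ ∣ S H ∣

GraphClass : Set₁
GraphClass = ∀ {n} → Graph n → Set

-- arrangeability of G is at most k: there is a linear order (given by a permutation π,
-- u ≺ v iff π u < π v) such that for every v, at most k vertices u ≺ v have a common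
-- neighbour w of u and v with v ≺ w.
arrAtMost : ∀ {n} → Graph n → ℕ → Set
arrAtMost {n} G k = Σ (Permutation′ n) λ π → ∀ v →
  count (λ u → (toℕ (π ⟨$⟩ʳ u) <ᵇ toℕ (π ⟨$⟩ʳ v)) ∧
               anyB (λ w → adj G u w ∧ adj G v w ∧ (toℕ (π ⟨$⟩ʳ v) <ᵇ toℕ (π ⟨$⟩ʳ w))))
    ℕ.≤ k

{-# OPTIONS --safe #-}
module Submission where

-- (iv) ⇒ (i): orient every edge of G_Σ towards its later endpoint v. An edge with a witness w after v
-- is counted by arrangeability. As the earlier neighbours of v are, but for the last one, all
-- counted at that last one, there are at most k + 1 witnesses w before v, with ρ edges each.
--
-- (iii) ⇒ (iv): the order is built from its end; the next vertex must have few neighbours and few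
-- common neighbourhoods (through vertices placed later) in the set A of unplaced vertices. Let
-- distinct vertices w choose distinct pairs in N(w) ∩ A, as many as possible. By (iii) the chosen
-- pairs form a sparse graph Γ, hence without large cliques; by maximality N(w) ∩ A is a clique of
-- Γ for every w that chooses nothing. So at most b|A|/2 vertices w have at least b + 2 neighbours
-- in A, for every A. Applied to a greedy small cover of the vertices of high degree, this shows
-- that at most half of A has high degree in A. Placed vertices thus keep a bounded degree
-- into A, so the choosing ones join only O(|A|) pairs of A, and the rest of the pairs lie in Γ.

open import Defs
open import Relation.Binary.PropositionalEquality using (_≡_)
open import Data.Product using (Σ; _×_)

module Combinatorics where
  open import Data.Nat
  open import Data.Nat.Properties
  open import Data.Bool using (Bool; true; false; if_then_else_; _∧_; _∨_; not; T)
  open import Data.Fin using (Fin; zero; suc)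
  import Data.Fin as Fin
  import Data.Fin.Properties as Fin
  open import Data.Fin.Permutation using (Permutation′; permutation; _⟨$⟩ʳ_; _⟨$⟩ˡ_; inverseˡ)
  open import Data.Fin.Subset using (Subset; _∈_; ∣_∣)
  open import Data.Product using (∃; _,_; proj₁; proj₂)
  open import Data.Vec using (lookup; tabulate; []; _∷_)
  open import Data.Vec.Properties using ([]=⇒lookup; lookup⇒[]=; lookup∘tabulate)
  open import Data.Sum using (_⊎_; inj₁; inj₂)
  open import Function using (_∘_)
  open import Relation.Binary.PropositionalEquality as ≡ using (refl; cong; cong₂; module ≡-Reasoning; _≢_)
  open import Relation.Nullary using (Dec; yes; no; contradiction)
  open import Relation.Nullary.Decidable using (⌊_⌋; _×-dec_)
  open import Relation.Binary.Definitions using (tri<; tri≈; tri>)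
  import Data.Bool as Bool
  open import Data.Bool.Properties using (∨-comm; ∧-comm)
  open import Data.Nat.Tactic.RingSolver using (solve-∀)

  -- Booleans and their indicators.

  ⟦_⟧ : Bool → ℕ
  ⟦ b ⟧ = if b then 1 else 0

  ⟦⟧≤ : ∀ {b x} → (b ≡ true → 1 ≤ x) → ⟦ b ⟧ ≤ x
  ⟦⟧≤ {true}  h = h refl
  ⟦⟧≤ {false} h = z≤n

  ⟦true⟧ : ∀ {b} → b ≡ true → 1 ≤ ⟦ b ⟧
  ⟦true⟧ refl = ≤-refl

  0<⟦⟧ : ∀ {b} → 0 < ⟦ b ⟧ → b ≡ true
  0<⟦⟧ {true} _ = refl

  ⟦∧⟧ : ∀ a b → ⟦ a ∧ b ⟧ ≡ ⟦ a ⟧ * ⟦ b ⟧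
  ⟦∧⟧ true  b = ≡.sym (+-identityʳ ⟦ b ⟧)
  ⟦∧⟧ false b = refl

  true≢false : true ≢ false
  true≢false ()

  ∧⁻ˡ : ∀ {a b} → a ∧ b ≡ true → a ≡ true
  ∧⁻ˡ {true} _ = refl

  ∧⁻ʳ : ∀ {a b} → a ∧ b ≡ true → b ≡ true
  ∧⁻ʳ {true} e = e

  ∧⁺ : ∀ {a b} → a ≡ true → b ≡ true → a ∧ b ≡ true
  ∧⁺ refl refl = refl

  ∨⁻ : ∀ {a b} → a ∨ b ≡ true → a ≡ true ⊎ b ≡ true
  ∨⁻ {true}  _ = inj₁ refl
  ∨⁻ {false} e = inj₂ e

  ∨⁺ʳ : ∀ {a b} → b ≡ true → a ∨ b ≡ true
  ∨⁺ʳ {true}  _ = refl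
  ∨⁺ʳ {false} e = e

  ∨⁺ˡ : ∀ {a b} → a ≡ true → a ∨ b ≡ true
  ∨⁺ˡ refl = refl

  not⁻ : ∀ {a} → not a ≡ true → a ≡ false
  not⁻ {false} _ = refl

  not⁺ : ∀ {a} → a ≡ false → not a ≡ true
  not⁺ refl = refl

  <ᵇ⁻ : ∀ {m n} → (m <ᵇ n) ≡ true → m < n
  <ᵇ⁻ {m} {n} e = <ᵇ⇒< m n (≡.subst T (≡.sym e) _)

  <ᵇ⁺ : ∀ {m n} → m < n → (m <ᵇ n) ≡ true
  <ᵇ⁺ {m} {n} m<n with m <ᵇ n | <⇒<ᵇ m<n
  ... | true | _ = refl

  ≟⁻ : ∀ {n} {u v : Fin n} → ⌊ u Fin.≟ v ⌋ ≡ true → u ≡ v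
  ≟⁻ {u = u} {v} e with u Fin.≟ v
  ... | yes p = p

  ≟-refl : ∀ {n} (u : Fin n) → ⌊ u Fin.≟ u ⌋ ≡ true
  ≟-refl u with u Fin.≟ u
  ... | yes _ = refl
  ... | no ¬p = contradiction refl ¬p

  ≢⇒≟ : ∀ {n} {u v : Fin n} → u ≢ v → ⌊ u Fin.≟ v ⌋ ≡ false
  ≢⇒≟ {u = u} {v} u≢v with u Fin.≟ v
  ... | yes p = contradiction p u≢v
  ... | no _  = refl

  anyB⁻ : ∀ {n} {p : Fin n → Bool} → anyB p ≡ true → ∃ λ i → p i ≡ true
  anyB⁻ {suc n} {p} e with ∨⁻ {p zero} e
  ... | inj₁ e₀ = zero , e₀
  ... | inj₂ e₁ with i , ei ← anyB⁻ e₁ = suc i , ei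

  anyB⁺ : ∀ {n} {p : Fin n → Bool} i → p i ≡ true → anyB p ≡ true
  anyB⁺ zero    e = ∨⁺ˡ e
  anyB⁺ {p = p} (suc i) e = ∨⁺ʳ {p zero} (anyB⁺ i e)

  -- Finite sums, maxima and counts.

  sum-mono : ∀ {n} {f g : Fin n → ℕ} → (∀ i → f i ≤ g i) → sumF f ≤ sumF g
  sum-mono {zero}  h = z≤n
  sum-mono {suc n} h = +-mono-≤ (h zero) (sum-mono (h ∘ suc))

  sum-cong : ∀ {n} {f g : Fin n → ℕ} → (∀ i → f i ≡ g i) → sumF f ≡ sumF g
  sum-cong {zero}  h = refl
  sum-cong {suc n} h = cong₂ _+_ (h zero) (sum-cong (h ∘ suc))

  sum-0 : ∀ n → sumF {n} (λ _ → 0) ≡ 0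
  sum-0 zero    = refl
  sum-0 (suc n) = sum-0 n

  sum-+ : ∀ {n} (f g : Fin n → ℕ) → sumF (λ i → f i + g i) ≡ sumF f + sumF g
  sum-+ {zero}  f g = refl
  sum-+ {suc n} f g = ≡.trans (cong (f zero + g zero +_) (sum-+ (f ∘ suc) (g ∘ suc)))
    (interchange (f zero) (g zero) _ _)
    where
    interchange : ∀ a b c d → a + b + (c + d) ≡ a + c + (b + d)
    interchange = solve-∀

  sum-*ˡ : ∀ {n} c (f : Fin n → ℕ) → sumF (λ i → c * f i) ≡ c * sumF f
  sum-*ˡ {zero}  c f = ≡.sym (*-zeroʳ c)
  sum-*ˡ {suc n} c f = ≡.trans (cong (c * f zero +_) (sum-*ˡ c (f ∘ suc)))
    (≡.sym (*-distribˡ-+ c (f zero) _))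

  sum-*ʳ : ∀ {n} (f : Fin n → ℕ) c → sumF (λ i → f i * c) ≡ sumF f * c
  sum-*ʳ f c = ≡.trans (sum-cong (λ i → *-comm (f i) c)) (≡.trans (sum-*ˡ c f) (*-comm c _))

  sum-swap : ∀ {m n} (f : Fin m → Fin n → ℕ) →
    sumF (λ i → sumF (f i)) ≡ sumF (λ j → sumF (λ i → f i j))
  sum-swap {zero}  {n} f = ≡.sym (sum-0 n)
  sum-swap {suc m} f = ≡.trans (cong (sumF (f zero) +_) (sum-swap (f ∘ suc)))
    (≡.sym (sum-+ (f zero) _))

  ≤sum : ∀ {n} (f : Fin n → ℕ) i → f i ≤ sumF f
  ≤sum f zero    = m≤m+n _ _
  ≤sum f (suc i) = ≤-trans (≤sum (f ∘ suc) i) (m≤n+m _ (f zero))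

  0<sum : ∀ {n} {f : Fin n → ℕ} → 0 < sumF f → ∃ λ i → 0 < f i
  0<sum {suc n} {f} h with f zero in e
  ... | suc _ = zero , ≡.subst (0 <_) (≡.sym e) z<s
  ... | zero with i , hi ← 0<sum h = suc i , hi

  sum-point : ∀ {n} (a : Fin n) → sumF (λ i → ⟦ ⌊ i Fin.≟ a ⌋ ⟧) ≡ 1
  sum-point {suc n} zero    = cong suc (sum-0 n)
  sum-point {suc n} (suc a) = ≡.trans (sum-cong eq) (sum-point a)
    where
    eq : ∀ i → ⟦ ⌊ suc i Fin.≟ suc a ⌋ ⟧ ≡ ⟦ ⌊ i Fin.≟ a ⌋ ⟧
    eq i with i Fin.≟ a
    ... | yes _ = refl
    ... | no _  = refl

  count≡sum : ∀ {n} (p : Fin n → Bool) → count p ≡ sumF (λ i → ⟦ p i ⟧)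
  count≡sum {zero}  p = refl
  count≡sum {suc n} p = cong (⟦ p zero ⟧ +_) (count≡sum (p ∘ suc))

  count-mono : ∀ {n} {p q : Fin n → Bool} → (∀ i → p i ≡ true → q i ≡ true) → count p ≤ count q
  count-mono {p = p} {q} h = ≡.subst₂ _≤_ (≡.sym (count≡sum p)) (≡.sym (count≡sum q))
    (sum-mono (λ i → ⟦⟧≤ (⟦true⟧ ∘ h i)))

  ≤max : ∀ {n} (f : Fin n → ℕ) i → f i ≤ maxF f
  ≤max f zero    = m≤m⊔n _ _
  ≤max f (suc i) = ≤-trans (≤max (f ∘ suc) i) (m≤n⊔m (f zero) _)

  max≤ : ∀ {n} {f : Fin n → ℕ} {c} → (∀ i → f i ≤ c) → maxF f ≤ c
  max≤ {zero}  h = z≤n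
  max≤ {suc n} h = ⊔-lub (h zero) (max≤ (h ∘ suc))

  sum² : ∀ {m n} → (Fin m → Fin n → ℕ) → ℕ
  sum² f = sumF (λ i → sumF (f i))

  count-0 : ∀ n → count {n} (λ _ → false) ≡ 0
  count-0 zero    = refl
  count-0 (suc n) = count-0 n

  count≤n : ∀ {n} (p : Fin n → Bool) → count p ≤ n
  count≤n {zero}  p = z≤n
  count≤n {suc n} p = +-mono-≤ (⟦⟧≤ {p zero} λ _ → ≤-refl) (count≤n (p ∘ suc))

  count-cong : ∀ {n} {p q : Fin n → Bool} → (∀ i → p i ≡ q i) → count p ≡ count q
  count-cong {zero}  h = refl
  count-cong {suc n} h = cong₂ (λ b m → ⟦ b ⟧ + m) (h zero) (count-cong (h ∘ suc))

  insert : ∀ {n} → Fin n → (Fin n → Bool) → Fin n → Bool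
  insert a p i = ⌊ i Fin.≟ a ⌋ ∨ p i

  count-insert : ∀ {n} a (p : Fin n → Bool) → p a ≡ false → count (insert a p) ≡ suc (count p)
  count-insert {n} a p pa = begin
    count (insert a p)                                        ≡⟨ count≡sum (insert a p) ⟩
    sumF (λ i → ⟦ insert a p i ⟧)                             ≡⟨ sum-cong {n} pointwise ⟩
    sumF (λ i → ⟦ ⌊ i Fin.≟ a ⌋ ⟧ + ⟦ p i ⟧)                  ≡⟨ sum-+ {n} _ _ ⟩
    sumF (λ i → ⟦ ⌊ i Fin.≟ a ⌋ ⟧) + sumF (λ i → ⟦ p i ⟧)
      ≡⟨ cong₂ _+_ (sum-point a) (≡.sym (count≡sum p)) ⟩
    suc (count p) ∎
    where
    open ≡-Reasoning
    pointwise : ∀ i → ⟦ insert a p i ⟧ ≡ ⟦ ⌊ i Fin.≟ a ⌋ ⟧ + ⟦ p i ⟧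
    pointwise i with i Fin.≟ a
    ... | yes refl = cong (λ b → suc ⟦ b ⟧) (≡.sym pa)
    ... | no _     = refl

  count-⊂ : ∀ {n} a {p q : Fin n → Bool} → (∀ i → p i ≡ true → q i ≡ true) →
    p a ≡ false → q a ≡ true → count p < count q
  count-⊂ a {p} {q} p⊆q pa qa = ≤-trans (≤-reflexive (≡.sym (count-insert a p pa))) (count-mono sub′)
    where
    sub′ : ∀ i → insert a p i ≡ true → q i ≡ true
    sub′ i e with i Fin.≟ a
    ... | yes refl = qa
    ... | no _     = p⊆q i e

  sum²-∧ : ∀ {m n} (p : Fin m → Bool) (q : Fin n → Bool) →
    sum² (λ u v → ⟦ p u ∧ q v ⟧) ≡ count p * count q
  sum²-∧ {m} {n} p q = begin
    sum² (λ u v → ⟦ p u ∧ q v ⟧)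
      ≡⟨ sum-cong {m} (λ u → ≡.trans (sum-cong {n} (λ v → ⟦∧⟧ (p u) (q v))) (sum-*ˡ {n} ⟦ p u ⟧ _)) ⟩
    sumF (λ u → ⟦ p u ⟧ * sumF (λ v → ⟦ q v ⟧))       ≡⟨ sum-*ʳ {m} _ _ ⟩
    sumF (λ u → ⟦ p u ⟧) * sumF (λ v → ⟦ q v ⟧)
      ≡⟨ cong₂ _*_ (count≡sum p) (count≡sum q) ⟨
    count p * count q ∎
    where open ≡-Reasoning

  count-point : ∀ {n} (a : Fin n) → count (λ i → ⌊ i Fin.≟ a ⌋) ≡ 1
  count-point a = ≡.trans (count≡sum (λ i → ⌊ i Fin.≟ a ⌋)) (sum-point a)

  sum²-mono : ∀ {m n} {f g : Fin m → Fin n → ℕ} → (∀ u v → f u v ≤ g u v) → sum² f ≤ sum² g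
  sum²-mono h = sum-mono (λ u → sum-mono (h u))

  sum²-+ : ∀ {m n} (f g : Fin m → Fin n → ℕ) → sum² (λ u v → f u v + g u v) ≡ sum² f + sum² g
  sum²-+ {m} {n} f g = ≡.trans (sum-cong {m} (λ u → sum-+ (f u) (g u))) (sum-+ {m} _ _)

  -- As `r` separates the ends of every edge, exactly one of its two orientations ascends. Used with
  -- two rankings, `toℕ` and the position in an arrangement, this moves `edgeCount` from the order
  -- of the labels to the arrangement.
  handshake : ∀ {n} (r : Fin n → ℕ) (F : Fin n → Fin n → Bool) →
    (∀ u v → F u v ≡ F v u) → (∀ u v → F u v ≡ true → r u ≢ r v) →
    sum² (λ u v → ⟦ F u v ⟧) ≡ 2 * sum² (λ u v → ⟦ (r u <ᵇ r v) ∧ F u v ⟧)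
  handshake r F F-sym F-≢ = begin
    sum² (λ u v → ⟦ F u v ⟧)
      ≡⟨ sum-cong (λ u → ≡.trans (sum-cong (split u)) (sum-+ (X u) _)) ⟩
    sumF (λ u → sumF (X u) + sumF (λ v → X v u))  ≡⟨ sum-+ (λ u → sumF (X u)) _ ⟩
    sum² X + sum² (λ u v → X v u)                 ≡⟨ cong (sum² X +_) (sum-swap X) ⟨
    sum² X + sum² X                               ≡⟨ cong (sum² X +_) (+-identityʳ _) ⟨
    2 * sum² X ∎
    where
    open ≡-Reasoning
    X : _ → _ → ℕ
    X u v = ⟦ (r u <ᵇ r v) ∧ F u v ⟧
    split : ∀ u v → ⟦ F u v ⟧ ≡ X u v + X v u
    split u v rewrite F-sym v u with F u v in Fuv | r u <ᵇ r v in uv | r v <ᵇ r u in vu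
    ... | false | true  | true  = refl
    ... | false | true  | false = refl
    ... | false | false | true  = refl
    ... | false | false | false = refl
    ... | true  | true  | true  = contradiction (<ᵇ⁻ vu) (<-asym (<ᵇ⁻ {r u} uv))
    ... | true  | true  | false = refl
    ... | true  | false | true  = refl
    ... | true  | false | false = contradiction
      (≤-antisym (≮⇒≥ λ lt → true≢false (≡.trans (≡.sym (<ᵇ⁺ lt)) vu))
                 (≮⇒≥ λ lt → true≢false (≡.trans (≡.sym (<ᵇ⁺ lt)) uv)))
      (F-≢ u v Fuv)

  -- Each failure of `Q` yields a larger measure, which can happen only boundedly often. This
  -- supplies the last earlier neighbour, the saturated pairing and the maximal cover.
  saturate : {X : Set} {Q : X → Set} (μ : X → ℕ) (bound : ℕ) → (∀ x → μ x ≤ bound) →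
    (∀ x → Q x ⊎ ∃ λ y → μ x < μ y) → X → ∃ Q
  saturate {X} {Q} μ bound μ≤ step x₀ = go bound x₀ (m≤n+m bound (μ x₀))
    where
    go : ∀ fuel x → bound ≤ μ x + fuel → ∃ Q
    -- The fuel covers the distance from `μ x` to the bound, so once it is spent a further increase
    -- would exceed the bound.
    go fuel x h with step x
    go fuel x h | inj₁ q = x , q
    go zero x h | inj₂ (y , lt) =
      contradiction (≤-trans lt (≤-trans (μ≤ y) (≤-trans h (≤-reflexive (+-identityʳ _))))) (<-irrefl refl)
    go (suc fuel) x h | inj₂ (y , lt) =
      go fuel y (≤-trans h (≤-trans (≤-reflexive (+-suc (μ x) fuel)) (+-monoˡ-≤ fuel lt)))

  -- If y had no preimage, punching y out of the codomain would give an injection of `Fin (suc n)`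
  -- into `Fin n`.
  injective⇒surjective : ∀ {n} (f : Fin n → Fin n) → (∀ {u v} → f u ≡ f v → u ≡ v) →
    ∀ y → ∃ λ x → f x ≡ y
  injective⇒surjective {suc n} f f-inj y with Fin.any? (λ x → f x Fin.≟ y)
  ... | yes found = found
  ... | no ∄ = contradiction
    (Fin.injective⇒≤ {f = λ x → Fin.punchOut (missed x)}
      (λ eq → f-inj (Fin.punchOut-injective (missed _) (missed _) eq)))
    1+n≰n
    where
    missed : ∀ x → y ≢ f x
    missed x eq = ∄ (x , ≡.sym eq)

  injective⇒permutation : ∀ {n} (f : Fin n → Fin n) → (∀ {u v} → f u ≡ f v → u ≡ v) → Permutation′ n
  injective⇒permutation f f-inj =
    permutation f (proj₁ ∘ surj) (proj₂ ∘ surj) (λ x → f-inj (proj₂ (surj (f x))))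
    where surj = injective⇒surjective f f-inj

  -- Neighborhood systems and the edges of their subgraphs.

  ∣∣≡count : ∀ {n} (p : Subset n) → ∣ p ∣ ≡ count (lookup p)
  ∣∣≡count []          = refl
  ∣∣≡count (true  ∷ p) = cong suc (∣∣≡count p)
  ∣∣≡count (false ∷ p) = ∣∣≡count p

  sys⊆adj : ∀ {n} {G : Graph n} (Sg : NeighborhoodSystem G) {w u} →
    lookup (sys Sg w) u ≡ true → adj G w u ≡ true
  sys⊆adj Sg {w} {u} e =
    ≡.trans (≡.sym (lookup∘tabulate _ u)) ([]=⇒lookup (sub Sg w (lookup⇒[]= u _ e)))

  adjΣ⁻ : ∀ {n} {G : Graph n} (Sg : NeighborhoodSystem G) {u v} → adjΣ Sg u v ≡ true →
    u ≢ v × ∃ λ w → lookup (sys Sg w) u ≡ true × lookup (sys Sg w) v ≡ true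
  adjΣ⁻ Sg {u} {v} e =
    let w , ew = anyB⁻ (∧⁻ʳ {not ⌊ u Fin.≟ v ⌋} e) in
    (λ { refl → true≢false (≡.trans (≡.sym (≟-refl u)) (not⁻ (∧⁻ˡ e))) }) ,
    w , ∧⁻ˡ ew , ∧⁻ʳ {lookup (sys Sg w) u} ew

  adj⇒≢ : ∀ {n} (G : Graph n) {u v} → adj G u v ≡ true → u ≢ v
  adj⇒≢ G e refl = true≢false (≡.trans (≡.sym e) (irrefl G _))

  edge⇒≢ : ∀ {n} {G : Graph n} {Sg : NeighborhoodSystem G} (H : Subgraph Sg) {u v} →
    F H u v ≡ true → u ≢ v
  edge⇒≢ {Sg = Sg} H {u} {v} e = proj₁ (adjΣ⁻ Sg (proj₂ (proj₂ (Fsub H u v e))))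

  -- Over ordered pairs each edge counts twice; the order of the labels disappears, and later
  -- estimates concern double sums only.
  2edgeCount : ∀ {n} {G : Graph n} {Sg : NeighborhoodSystem G} (H : Subgraph Sg) →
    2 * edgeCount (F H) ≡ sum² (λ u v → ⟦ F H u v ⟧)
  2edgeCount {n} H = ≡.trans
    (cong (2 *_) (sum-cong {n} (λ u → count≡sum (λ v → (Fin.toℕ u <ᵇ Fin.toℕ v) ∧ F H u v))))
    (≡.sym (handshake Fin.toℕ (F H) (Fsym H) (λ u v e eq → edge⇒≢ H e (Fin.toℕ-injective eq))))

  -- Bounded arrangeability gives a linear bound on mad.

  module Arranged {n} (G : Graph n) (k : ℕ) (π : Permutation′ n) where

    r : Fin n → ℕ
    r u = Fin.toℕ (π ⟨$⟩ʳ u)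

    r-injective : ∀ {u v} → r u ≡ r v → u ≡ v
    r-injective {u} {v} eq = ≡.trans (≡.sym (inverseˡ π {u}))
      (≡.trans (cong (π ⟨$⟩ˡ_) (Fin.toℕ-injective eq)) (inverseˡ π {v}))

    -- The set that `arrAtMost` bounds at v, for the positions `r`.
    close : Fin n → Fin n → Bool
    close v u = (r u <ᵇ r v) ∧ anyB (λ w → adj G u w ∧ adj G v w ∧ (r v <ᵇ r w))

    module _ (close≤k : ∀ v → count (close v) ≤ k) where

      back : Fin n → Fin n → Bool
      back v w = (r w <ᵇ r v) ∧ adj G w v

      -- All earlier neighbours of v are close to the last one of them, through v.
      back≤ : ∀ v → count (back v) ≤ suc k
      back≤ v with 0 <? sumF (λ w → ⟦ back v w ⟧)
      ... | no ≮ = ≤-trans (≤-reflexive (count≡sum (back v))) (≤-trans (≮⇒≥ ≮) z≤n)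
      ... | yes pos with w₀ , b₀ ← 0<sum pos
        with saturate {∃ λ w → back v w ≡ true} {λ (w , _) → ∀ x → back v x ≡ true → r x ≤ r w}
               (r ∘ proj₁) n (λ (w , _) → <⇒≤ (Fin.toℕ<n (π ⟨$⟩ʳ w))) step (w₀ , 0<⟦⟧ b₀)
        where
        step : ∀ ((w , _) : ∃ λ w → back v w ≡ true) →
          (∀ x → back v x ≡ true → r x ≤ r w) ⊎ ∃ λ ((y , _) : ∃ λ w → back v w ≡ true) → r w < r y
        step (w , _) with Fin.any? (λ x → (back v x Bool.≟ true) ×-dec (r w <? r x))
        ... | yes (x , bx , lt) = inj₂ ((x , bx) , lt)
        ... | no ∄ = inj₁ λ x bx → ≮⇒≥ λ lt → ∄ (x , bx , lt)
      ... | (w* , b*) , last = begin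
        count (back v)                                         ≡⟨ count≡sum (back v) ⟩
        sumF (λ w → ⟦ back v w ⟧)                              ≤⟨ sum-mono (λ w → ⟦⟧≤ (pointwise w)) ⟩
        sumF (λ w → ⟦ ⌊ w Fin.≟ w* ⌋ ⟧ + ⟦ close w* w ⟧)       ≡⟨ sum-+ {n} _ _ ⟩
        sumF (λ w → ⟦ ⌊ w Fin.≟ w* ⌋ ⟧) + sumF (λ w → ⟦ close w* w ⟧)
          ≡⟨ cong₂ _+_ (sum-point w*) (≡.sym (count≡sum (close w*))) ⟩
        suc (count (close w*))                                 ≤⟨ s≤s (close≤k w*) ⟩
        suc k ∎
        where
        open ≤-Reasoning
        pointwise : ∀ w → back v w ≡ true → 1 ≤ ⟦ ⌊ w Fin.≟ w* ⌋ ⟧ + ⟦ close w* w ⟧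
        pointwise w bw with w Fin.≟ w*
        ... | yes _ = s≤s z≤n
        ... | no w≢ = ⟦true⟧ (∧⁺ (<ᵇ⁺ (≤∧≢⇒< (last w bw) (w≢ ∘ r-injective)))
          (anyB⁺ v (∧⁺ (∧⁻ʳ {r w <ᵇ r v} bw)
            (∧⁺ (∧⁻ʳ {r w* <ᵇ r v} b*) (∧⁻ˡ b*)))))

      module _ (Sg : NeighborhoodSystem G) (H : Subgraph Sg) where

        inS : Fin n → Fin n → Bool
        inS w u = lookup (sys Sg w) u

        inS≤ρ : ∀ w → sumF (λ u → ⟦ inS w u ⟧) ≤ ρ Sg
        inS≤ρ w = ≤-trans (≤-reflexive (≡.trans (≡.sym (count≡sum (inS w))) (≡.sym (∣∣≡count (sys Sg w)))))
          (≤max (λ w → ∣ sys Sg w ∣) w)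

        -- A witness w of the edge is a neighbour of v, hence not v itself. If w lies after v, then
        -- u is close to v, and the weight `ρ Sg` is at least 1 because u is in `sys Sg w`. If w
        -- lies before v, it is an earlier neighbour of v that has u in its set.
        charge : ∀ u v → (r u <ᵇ r v) ∧ F H u v ≡ true →
          1 ≤ ⟦ close v u ⟧ * ρ Sg + sumF (λ w → ⟦ back v w ⟧ * ⟦ inS w u ⟧)
        charge u v e with Fsub H u v (∧⁻ʳ {r u <ᵇ r v} e)
        ... | _ , _ , uv with adjΣ⁻ Sg uv
        ... | u≢v , w , wu , wv with <-cmp (r w) (r v)
        ... | tri< w<v _ _ = ≤-trans
          (≤-trans (*-mono-≤ (⟦true⟧ (∧⁺ (<ᵇ⁺ w<v) (sys⊆adj Sg wv))) (⟦true⟧ wu))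
            (≤sum (λ w → ⟦ back v w ⟧ * ⟦ inS w u ⟧) w))
          (m≤n+m _ _)
        ... | tri≈ _ w≡v _ = contradiction (r-injective w≡v) (adj⇒≢ G (sys⊆adj Sg wv))
        ... | tri> _ _ v<w = ≤-trans (*-mono-≤ (⟦true⟧ {close v u} (∧⁺ (∧⁻ˡ {r u <ᵇ r v} e)
            (anyB⁺ {p = λ w → adj G u w ∧ adj G v w ∧ (r v <ᵇ r w)} w (∧⁺ (≡.trans (sym G u w) (sys⊆adj Sg wu))
              (∧⁺ (≡.trans (sym G v w) (sys⊆adj Sg wv)) (<ᵇ⁺ v<w))))))
            (≤-trans (≤-trans (⟦true⟧ wu) (≤sum (λ u → ⟦ inS w u ⟧) u)) (inS≤ρ w)))
          (m≤m+n _ _)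

        backDegree : ∀ v → sumF (λ u → ⟦ (r u <ᵇ r v) ∧ F H u v ⟧) ≤ (k + suc k) * ρ Sg
        backDegree v = begin
          sumF (λ u → ⟦ (r u <ᵇ r v) ∧ F H u v ⟧)   ≤⟨ sum-mono (λ u → ⟦⟧≤ (charge u v)) ⟩
          sumF (λ u → ⟦ close v u ⟧ * ρ Sg + sumF (λ w → ⟦ back v w ⟧ * ⟦ inS w u ⟧))
            ≡⟨ sum-+ {n} _ _ ⟩
          sumF (λ u → ⟦ close v u ⟧ * ρ Sg) + sum² (λ u w → ⟦ back v w ⟧ * ⟦ inS w u ⟧)
            ≤⟨ +-mono-≤ near far ⟩
          k * ρ Sg + suc k * ρ Sg                   ≡⟨ *-distribʳ-+ (ρ Sg) k (suc k) ⟨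
          (k + suc k) * ρ Sg ∎
          where
          open ≤-Reasoning
          near : sumF (λ u → ⟦ close v u ⟧ * ρ Sg) ≤ k * ρ Sg
          near = ≤-trans (≤-reflexive (≡.trans (sum-*ʳ {n} _ (ρ Sg))
              (cong (_* ρ Sg) (≡.sym (count≡sum (close v))))))
            (*-monoˡ-≤ (ρ Sg) (close≤k v))
          far : sum² (λ u w → ⟦ back v w ⟧ * ⟦ inS w u ⟧) ≤ suc k * ρ Sg
          far = begin
            sum² (λ u w → ⟦ back v w ⟧ * ⟦ inS w u ⟧)  ≡⟨ sum-swap {n} {n} _ ⟩
            sum² (λ w u → ⟦ back v w ⟧ * ⟦ inS w u ⟧)
              ≤⟨ sum-mono (λ w → ≤-trans (≤-reflexive (sum-*ˡ {n} ⟦ back v w ⟧ _))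
                   (*-monoʳ-≤ ⟦ back v w ⟧ (inS≤ρ w))) ⟩
            sumF (λ w → ⟦ back v w ⟧ * ρ Sg)          ≡⟨ sum-*ʳ {n} _ (ρ Sg) ⟩
            sumF (λ w → ⟦ back v w ⟧) * ρ Sg          ≡⟨ cong (_* ρ Sg) (count≡sum (back v)) ⟨
            count (back v) * ρ Sg                     ≤⟨ *-monoˡ-≤ (ρ Sg) (back≤ v) ⟩
            suc k * ρ Sg ∎

        edges≤ : 2 * edgeCount (F H) ≤ 2 * (k + suc k) * ρ Sg * ∣ S H ∣
        edges≤ = begin
          2 * edgeCount (F H)                        ≡⟨ 2edgeCount H ⟩
          sum² (λ u v → ⟦ F H u v ⟧)
            ≡⟨ handshake r (F H) (Fsym H) (λ u v e eq → edge⇒≢ H e (r-injective eq)) ⟩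
          2 * sum² (λ u v → ⟦ (r u <ᵇ r v) ∧ F H u v ⟧)
            ≡⟨ cong (2 *_) (sum-swap {n} {n} _) ⟩
          2 * sum² (λ v u → ⟦ (r u <ᵇ r v) ∧ F H u v ⟧)
            ≤⟨ *-monoʳ-≤ 2 (sum-mono perVertex) ⟩
          2 * sumF (λ v → ⟦ lookup (S H) v ⟧ * ((k + suc k) * ρ Sg))
            ≡⟨ cong (2 *_) (sum-*ʳ {n} _ ((k + suc k) * ρ Sg)) ⟩
          2 * (sumF (λ v → ⟦ lookup (S H) v ⟧) * ((k + suc k) * ρ Sg))
            ≡⟨ cong (λ s → 2 * (s * ((k + suc k) * ρ Sg)))
                 (≡.trans (∣∣≡count (S H)) (count≡sum (lookup (S H)))) ⟨
          2 * (∣ S H ∣ * ((k + suc k) * ρ Sg))       ≡⟨ rearrange (∣ S H ∣) (k + suc k) (ρ Sg) ⟩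
          2 * (k + suc k) * ρ Sg * ∣ S H ∣ ∎
          where
          open ≤-Reasoning
          rearrange : ∀ s c p → 2 * (s * (c * p)) ≡ 2 * c * p * s
          rearrange = solve-∀
          -- Edges of H end in its vertex set, so only these vertices are charged; this gives the
          -- factor |S| instead of n.
          perVertex : ∀ v → sumF (λ u → ⟦ (r u <ᵇ r v) ∧ F H u v ⟧)
            ≤ ⟦ lookup (S H) v ⟧ * ((k + suc k) * ρ Sg)
          perVertex v with lookup (S H) v in Sv
          ... | true  = ≤-trans (backDegree v) (m≤m+n _ 0)
          ... | false = ≤-trans (sum-mono λ u → ⟦⟧≤ {x = 0} λ e → contradiction
              (≡.trans (≡.sym ([]=⇒lookup (proj₁ (proj₂ (Fsub H u v (∧⁻ʳ {r u <ᵇ r v} e)))))) Sv)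
              true≢false)
            (≤-reflexive (sum-0 n))

  -- These constants stand outside the argument about one graph, as the bound on arrangeability must
  -- be the same for a whole class. `maxBackDegree b` is m + 4c for the thresholds m = b + 2 and c =
  -- 2bm of the covering argument. `meanCommon b` bounds the average of `count (common A v)` over v
  -- in A when every vertex outside A has at most `maxBackDegree b` neighbours in A.
  maxBackDegree meanCommon : ℕ → ℕ
  maxBackDegree b = 2 + b + 4 * (2 * b * (2 + b))
  meanCommon b = b + b * (maxBackDegree b * maxBackDegree b)

  -- From sparse pair systems to bounded arrangeability.

  module Sparse {n} (G : Graph n) (b₀ : ℕ)
    (sparse : ∀ (Sg : NeighborhoodSystem G) → ρ Sg ≡ 2 → (H : Subgraph Sg) →
      2 * edgeCount (F H) ≤ suc b₀ * ∣ S H ∣) where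

    -- A successor, so that c = 2bm is positive and can be cancelled.
    b : ℕ
    b = suc b₀

    -- If Γ has an edge, a witness w of it has two distinct vertices in `σ w`. This makes `ρ`
    -- exactly 2, and `sparse` applies to Γ as a subgraph with vertex set A. If Γ has no edge, `ρ`
    -- may be smaller, but the left side is 0.
    sparse-sum² : (σ : Fin n → Fin n → Bool) → (∀ {w u} → σ w u ≡ true → adj G w u ≡ true) →
      (∀ w → count (σ w) ≤ 2) →
      (A : Fin n → Bool) (Γ : Fin n → Fin n → Bool) → (∀ u v → Γ u v ≡ Γ v u) →
      (∀ {u v} → Γ u v ≡ true → A u ≡ true) →
      (∀ {u v} → Γ u v ≡ true → u ≢ v × ∃ λ w → σ w u ≡ true × σ w v ≡ true) →
      sum² (λ u v → ⟦ Γ u v ⟧) ≤ b * count A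
    sparse-sum² σ σ⊆adj σ≤2 A Γ Γ-sym Γ⊆A Γ-σ with 0 <? sum² (λ u v → ⟦ Γ u v ⟧)
    ... | no ≮ = ≤-trans (≮⇒≥ ≮) z≤n
    ... | yes pos with u , pos′ ← 0<sum pos with v , uv ← 0<sum {n} {λ v → ⟦ Γ u v ⟧} pos′ = begin
      sum² (λ u v → ⟦ Γ u v ⟧)  ≡⟨ 2edgeCount H ⟨
      2 * edgeCount Γ           ≤⟨ sparse Sg ρ≡2 H ⟩
      b * ∣ tabulate A ∣        ≡⟨ cong (b *_) (∣tabulate∣ A) ⟩
      b * count A ∎
      where
      open ≤-Reasoning
      ∣tabulate∣ : ∀ p → ∣ tabulate p ∣ ≡ count p
      ∣tabulate∣ p = ≡.trans (∣∣≡count (tabulate p)) (count-cong (lookup∘tabulate p))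
      ∈tabulate : ∀ p {u} → p u ≡ true → u ∈ tabulate p
      ∈tabulate p {u} e = lookup⇒[]= u _ (≡.trans (lookup∘tabulate p u) e)
      Sg : NeighborhoodSystem G
      Sg = record
        { sys = λ w → tabulate (σ w)
        ; sub = λ w {u} u∈ → ∈tabulate (adj G w)
            (σ⊆adj (≡.trans (≡.sym (lookup∘tabulate (σ w) u)) ([]=⇒lookup u∈))) }
      Γ⊆adjΣ : ∀ u v → Γ u v ≡ true → adjΣ Sg u v ≡ true
      Γ⊆adjΣ u v e with Γ-σ e
      ... | u≢v , w , wu , wv = ∧⁺ (not⁺ (≢⇒≟ u≢v))
        (anyB⁺ {p = λ w → lookup (tabulate (σ w)) u ∧ lookup (tabulate (σ w)) v} w
          (∧⁺ (≡.trans (lookup∘tabulate (σ w) u) wu) (≡.trans (lookup∘tabulate (σ w) v) wv)))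
      H : Subgraph Sg
      H = record
        { S = tabulate A
        ; nonemp = u , ∈tabulate A (Γ⊆A (0<⟦⟧ uv))
        ; F = Γ
        ; Fsym = Γ-sym
        ; Fsub = λ u v e → ∈tabulate A (Γ⊆A e) ,
            ∈tabulate A (Γ⊆A (≡.trans (Γ-sym v u) e)) , Γ⊆adjΣ u v e }
      2≤ρ : 2 ≤ ρ Sg
      2≤ρ with Γ-σ (0<⟦⟧ uv)
      ... | u≢v , w , wu , wv = begin
        2                                               ≡⟨ cong suc (count-point v) ⟨
        suc (count (λ i → ⌊ i Fin.≟ v ⌋))
          ≤⟨ count-⊂ u (λ i e → ≡.subst (λ i → σ w i ≡ true) (≡.sym (≟⁻ e)) wv) (≢⇒≟ u≢v) wu ⟩
        count (σ w)                                     ≡⟨ ∣tabulate∣ (σ w) ⟨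
        ∣ tabulate (σ w) ∣                              ≤⟨ ≤max (λ w → ∣ tabulate (σ w) ∣) w ⟩
        ρ Sg ∎
      ρ≡2 : ρ Sg ≡ 2
      ρ≡2 = ≤-antisym (max≤ (λ w → ≤-trans (≤-reflexive (∣tabulate∣ (σ w))) (σ≤2 w))) 2≤ρ

    -- Distinct vertices choosing distinct pairs.

    link : (Fin n → Bool) → Fin n → Fin n → Bool
    link A w u = A u ∧ adj G w u

    deg : (Fin n → Bool) → Fin n → ℕ
    deg A w = count (link A w)

    -- The vertices in W have chosen the pairs σ w, and Γ is the graph of these pairs.
    record Pairing (A : Fin n → Bool) : Set where
      field
        σ     : Fin n → Fin n → Bool
        σ⊆adj : ∀ {w u} → σ w u ≡ true → adj G w u ≡ true
        σ≤2   : ∀ w → count (σ w) ≤ 2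
        Γ     : Fin n → Fin n → Bool
        Γ-sym : ∀ u v → Γ u v ≡ Γ v u
        Γ⊆A   : ∀ {u v} → Γ u v ≡ true → A u ≡ true
        Γ-σ   : ∀ {u v} → Γ u v ≡ true → u ≢ v × ∃ λ w → σ w u ≡ true × σ w v ≡ true
        W     : Fin n → Bool
        σ⊆W   : ∀ {w u} → σ w u ≡ true → W w ≡ true
        W≤Γ   : 2 * count W ≤ sum² (λ u v → ⟦ Γ u v ⟧)

      Γ≤ : sum² (λ u v → ⟦ Γ u v ⟧) ≤ b * count A
      Γ≤ = sparse-sum² σ σ⊆adj σ≤2 A Γ Γ-sym Γ⊆A Γ-σ

    open Pairing

    ∅ : ∀ A → Pairing A
    ∅ A = record
      { σ = λ _ _ → false ; σ⊆adj = λ () ; σ≤2 = λ _ → ≤-trans (≤-reflexive (count-0 n)) z≤n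
      ; Γ = λ _ _ → false ; Γ-sym = λ _ _ → refl ; Γ⊆A = λ () ; Γ-σ = λ ()
      ; W = λ _ → false ; σ⊆W = λ ()
      ; W≤Γ = ≤-trans (≤-reflexive (cong (2 *_) (count-0 n))) z≤n }

    -- The new pair is not yet an edge of Γ, so it adds 2 to the double sum while W gains one
    -- vertex. This preserves `W≤Γ`, the inequality by which a pairing records that the chosen pairs
    -- are distinct.
    extend : ∀ {A} (P : Pairing A) w₀ u₀ v₀ → W P w₀ ≡ false →
      link A w₀ u₀ ≡ true → link A w₀ v₀ ≡ true → u₀ ≢ v₀ → Γ P u₀ v₀ ≡ false →
      ∃ λ P′ → count (W P) < count (W {A} P′)
    extend {A} P w₀ u₀ v₀ ∉W wu wv u₀≢v₀ ∉Γ = record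
      { σ = σ′ ; σ⊆adj = λ {w} {u} → σ′⊆adj w u ; σ≤2 = σ′≤2
      ; Γ = Γ′ ; Γ-sym = Γ′-sym ; Γ⊆A = λ {u} {v} → Γ′⊆A u v ; Γ-σ = λ {u} {v} → Γ′-σ u v
      ; W = insert w₀ (W P) ; σ⊆W = λ {w} {u} → σ′⊆W w u
      ; W≤Γ = W′≤Γ′ } , ≤-reflexive (≡.sym (count-insert w₀ (W P) ∉W))
      where
      ends : Fin n → Bool
      ends = insert u₀ (λ u → ⌊ u Fin.≟ v₀ ⌋)
      ends⁻ : ∀ {u} → ends u ≡ true → u ≡ u₀ ⊎ u ≡ v₀
      ends⁻ {u} e with ∨⁻ {⌊ u Fin.≟ u₀ ⌋} e
      ... | inj₁ p = inj₁ (≟⁻ p)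
      ... | inj₂ p = inj₂ (≟⁻ p)
      endu : ends u₀ ≡ true
      endu = ∨⁺ˡ (≟-refl u₀)
      endv : ends v₀ ≡ true
      endv = ∨⁺ʳ {⌊ v₀ Fin.≟ u₀ ⌋} (≟-refl v₀)

      σ′ : Fin n → Fin n → Bool
      σ′ w u = if ⌊ w Fin.≟ w₀ ⌋ then ends u else σ P w u
      σ′⊆adj : ∀ w u → σ′ w u ≡ true → adj G w u ≡ true
      σ′⊆adj w u e with w Fin.≟ w₀
      ... | no _ = σ⊆adj P e
      ... | yes refl with ends⁻ {u} e
      ... | inj₁ refl = ∧⁻ʳ {A u₀} wu
      ... | inj₂ refl = ∧⁻ʳ {A v₀} wv
      σ′≤2 : ∀ w → count (σ′ w) ≤ 2
      σ′≤2 w with w Fin.≟ w₀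
      ... | no _  = σ≤2 P w
      ... | yes _ = ≤-reflexive (≡.trans (count-insert u₀ _ (≢⇒≟ u₀≢v₀)) (cong suc (count-point v₀)))
      σ′⊆W : ∀ w u → σ′ w u ≡ true → insert w₀ (W P) w ≡ true
      σ′⊆W w u e with w Fin.≟ w₀
      ... | no _  = σ⊆W P e
      ... | yes _ = refl
      σ′-new : ∀ {u} → ends u ≡ true → σ′ w₀ u ≡ true
      σ′-new {u} e rewrite ≟-refl w₀ = e
      -- Redefining the choice at `w₀` loses nothing: `w₀` is outside W, where nothing has been
      -- chosen.
      σ′-old : ∀ {w u} → σ P w u ≡ true → σ′ w u ≡ true
      σ′-old {w} {u} e with w Fin.≟ w₀
      ... | no _     = e
      ... | yes refl = contradiction (≡.trans (≡.sym (σ⊆W P e)) ∉W) true≢false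

      pair : Fin n → Fin n → Bool
      pair u v = ⌊ u Fin.≟ u₀ ⌋ ∧ ⌊ v Fin.≟ v₀ ⌋
      pair⁻ : ∀ {u v} → pair u v ≡ true → u ≡ u₀ × v ≡ v₀
      pair⁻ {u} {v} e = ≟⁻ (∧⁻ˡ e) , ≟⁻ (∧⁻ʳ {⌊ u Fin.≟ u₀ ⌋} e)
      Γ′ : Fin n → Fin n → Bool
      Γ′ u v = (pair u v ∨ pair v u) ∨ Γ P u v
      Γ′-sym : ∀ u v → Γ′ u v ≡ Γ′ v u
      Γ′-sym u v = cong₂ _∨_ (∨-comm (pair u v) (pair v u)) (Γ-sym P u v)
      Γ′⁻ : ∀ u v → Γ′ u v ≡ true → (u ≡ u₀ × v ≡ v₀) ⊎ (u ≡ v₀ × v ≡ u₀) ⊎ Γ P u v ≡ true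
      Γ′⁻ u v e with ∨⁻ {pair u v ∨ pair v u} e
      ... | inj₂ q = inj₂ (inj₂ q)
      ... | inj₁ q with ∨⁻ {pair u v} q
      ... | inj₁ p = inj₁ (pair⁻ {u} {v} p)
      ... | inj₂ p with v≡ , u≡ ← pair⁻ {v} {u} p = inj₂ (inj₁ (u≡ , v≡))
      Γ′⊆A : ∀ u v → Γ′ u v ≡ true → A u ≡ true
      Γ′⊆A u v e with Γ′⁻ u v e
      ... | inj₁ (refl , _)        = ∧⁻ˡ wu
      ... | inj₂ (inj₁ (refl , _)) = ∧⁻ˡ wv
      ... | inj₂ (inj₂ q)          = Γ⊆A P q
      Γ′-σ : ∀ u v → Γ′ u v ≡ true → u ≢ v × ∃ λ w → σ′ w u ≡ true × σ′ w v ≡ true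
      Γ′-σ u v e with Γ′⁻ u v e
      ... | inj₁ (refl , refl)        = u₀≢v₀ , w₀ , σ′-new endu , σ′-new endv
      ... | inj₂ (inj₁ (refl , refl)) = u₀≢v₀ ∘ ≡.sym , w₀ , σ′-new endv , σ′-new endu
      ... | inj₂ (inj₂ q) with Γ-σ P q
      ... | u≢v , w , σu , σv         = u≢v , w , σ′-old σu , σ′-old σv

      -- The three sets are disjoint: `u₀≢v₀` separates the two orientations of the new pair, and
      -- `∉Γ` with the symmetry of Γ keeps both out of Γ.
      pointwise : ∀ u v → (⟦ pair u v ⟧ + ⟦ pair v u ⟧) + ⟦ Γ P u v ⟧ ≤ ⟦ Γ′ u v ⟧
      pointwise u v with pair u v in uv | pair v u in vu | Γ P u v in Γuv
      ... | false | false | _     = ≤-refl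
      ... | true  | false | false = ≤-refl
      ... | false | true  | false = ≤-refl
      ... | true  | true  | _     with refl , refl ← pair⁻ {u} {v} uv =
        contradiction (proj₁ (pair⁻ {v} {u} vu)) (u₀≢v₀ ∘ ≡.sym)
      ... | true  | false | true  with refl , refl ← pair⁻ {u} {v} uv =
        contradiction (≡.trans (≡.sym Γuv) ∉Γ) true≢false
      ... | false | true  | true  with refl , refl ← pair⁻ {v} {u} vu =
        contradiction (≡.trans (≡.sym Γuv) (≡.trans (Γ-sym P u v) ∉Γ)) true≢false

      sum²-pair : sum² (λ u v → ⟦ pair u v ⟧) ≡ 1
      sum²-pair = ≡.trans (sum²-∧ {n} {n} _ _) (cong₂ _*_ (count-point u₀) (count-point v₀))

      W′≤Γ′ : 2 * count (insert w₀ (W P)) ≤ sum² (λ u v → ⟦ Γ′ u v ⟧)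
      W′≤Γ′ = begin
        2 * count (insert w₀ (W P))   ≡⟨ cong (2 *_) (count-insert w₀ (W P) ∉W) ⟩
        2 * suc (count (W P))         ≡⟨ *-suc 2 (count (W P)) ⟩
        2 + 2 * count (W P)           ≤⟨ +-monoʳ-≤ 2 (W≤Γ P) ⟩
        2 + sum² (λ u v → ⟦ Γ P u v ⟧)
          ≡⟨ cong (_+ sum² (λ u v → ⟦ Γ P u v ⟧))
               (cong₂ _+_ sum²-pair (≡.trans (sum-swap {n} {n} _) sum²-pair)) ⟨
        sum² (λ u v → ⟦ pair u v ⟧) + sum² (λ u v → ⟦ pair v u ⟧) + sum² (λ u v → ⟦ Γ P u v ⟧)
          ≡⟨ cong (_+ sum² (λ u v → ⟦ Γ P u v ⟧)) (sum²-+ {n} {n} _ _) ⟨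
        sum² (λ u v → ⟦ pair u v ⟧ + ⟦ pair v u ⟧) + sum² (λ u v → ⟦ Γ P u v ⟧)
          ≡⟨ sum²-+ {n} {n} _ _ ⟨
        sum² (λ u v → (⟦ pair u v ⟧ + ⟦ pair v u ⟧) + ⟦ Γ P u v ⟧)
          ≤⟨ sum²-mono pointwise ⟩
        sum² (λ u v → ⟦ Γ′ u v ⟧) ∎
        where open ≤-Reasoning

    Saturated : ∀ {A} → Pairing A → Set
    Saturated {A} P = ∀ w u v → W P w ≡ false → link A w u ≡ true → link A w v ≡ true →
      u ≢ v → Γ P u v ≡ true

    -- A triple that violates saturation satisfies the premises of `extend`, and |W| cannot exceed
    -- n.
    saturatedPairing : ∀ A → ∃ (Saturated {A})
    saturatedPairing A = saturate (count ∘ W) n (count≤n ∘ W) step (∅ A)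
      where
      bad : Pairing A → Fin n → Fin n → Fin n → Bool
      bad P w u v = not (W P w) ∧ link A w u ∧ link A w v ∧ not ⌊ u Fin.≟ v ⌋ ∧ not (Γ P u v)
      step : ∀ P → Saturated P ⊎ ∃ λ P′ → count (W P) < count (W P′)
      step P with Fin.any? (λ w → Fin.any? (λ u → Fin.any? (λ v → bad P w u v Bool.≟ true)))
      ... | yes (w , u , v , e) = inj₂ (extend P w u v (not⁻ (∧⁻ˡ e)) (∧⁻ˡ e₁) (∧⁻ˡ e₂)
          (λ { refl → contradiction (≡.trans (≡.sym (≟-refl u)) (not⁻ (∧⁻ˡ e₃))) true≢false })
          (not⁻ (∧⁻ʳ {not ⌊ u Fin.≟ v ⌋} e₃)))
        where
        e₁ = ∧⁻ʳ {not (W P w)} e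
        e₂ = ∧⁻ʳ {link A w u} e₁
        e₃ = ∧⁻ʳ {link A w v} e₂
      ... | no ∄ = inj₁ sat
        where
        sat : Saturated P
        sat w u v ∉W wu wv u≢v with Γ P u v in Γuv
        ... | true  = refl
        ... | false = contradiction
          (w , u , v , ∧⁺ (not⁺ ∉W) (∧⁺ wu (∧⁺ wv (∧⁺ (not⁺ (≢⇒≟ u≢v)) (not⁺ Γuv))))) ∄


    2count-W≤ : ∀ {A} (P : Pairing A) → 2 * count (W P) ≤ b * count A
    2count-W≤ P = ≤-trans (W≤Γ P) (Γ≤ P)

    -- The links of unused vertices are cliques of Γ, and Γ contains no large clique.
    unused⇒deg≤ : ∀ {A} (P : Pairing A) → Saturated P → ∀ {w} → W P w ≡ false → deg A w ≤ suc b
    unused⇒deg≤ {A} P sat {w} ∉W = cancel (count L) bound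
      where
      open ≤-Reasoning
      L : Fin n → Bool
      L = link A w
      Φ : Fin n → Fin n → Bool
      Φ u v = (L u ∧ L v) ∧ Γ P u v
      pointwise : ∀ u v → L u ∧ L v ≡ true → 1 ≤ ⟦ L u ⟧ * ⟦ ⌊ v Fin.≟ u ⌋ ⟧ + ⟦ Φ u v ⟧
      pointwise u v e with v Fin.≟ u
      ... | yes refl = ≤-trans (*-mono-≤ (⟦true⟧ {L u} (∧⁻ˡ e)) (≤-refl {1})) (m≤m+n _ _)
      ... | no v≢u   = ≤-trans (⟦true⟧ {Φ u v} (∧⁺ e
        (sat w u v ∉W (∧⁻ˡ e) (∧⁻ʳ {L u} e) (v≢u ∘ ≡.sym)))) (m≤n+m _ _)
      diagonal : sum² (λ u v → ⟦ L u ⟧ * ⟦ ⌊ v Fin.≟ u ⌋ ⟧) ≡ count L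
      diagonal = ≡.trans
        (sum-cong {n} (λ u → ≡.trans (sum-*ˡ {n} ⟦ L u ⟧ _)
          (≡.trans (cong (⟦ L u ⟧ *_) (sum-point u)) (*-identityʳ ⟦ L u ⟧))))
        (≡.sym (count≡sum L))
      -- An ordered pair from L is diagonal or an edge of Γ. Sparsity is applied on the vertex set L
      -- rather than A, so the size s of L satisfies s² ≤ s + bs.
      bound : count L * count L ≤ suc b * count L
      bound = begin
        count L * count L                      ≡⟨ sum²-∧ L L ⟨
        sum² (λ u v → ⟦ L u ∧ L v ⟧)           ≤⟨ sum²-mono (λ u v → ⟦⟧≤ (pointwise u v)) ⟩
        sum² (λ u v → ⟦ L u ⟧ * ⟦ ⌊ v Fin.≟ u ⌋ ⟧ + ⟦ Φ u v ⟧)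
                                               ≡⟨ sum²-+ {n} {n} _ _ ⟩
        sum² (λ u v → ⟦ L u ⟧ * ⟦ ⌊ v Fin.≟ u ⌋ ⟧) + sum² (λ u v → ⟦ Φ u v ⟧)
          ≤⟨ +-mono-≤ (≤-reflexive diagonal) (sparse-sum² (σ P) (σ⊆adj P) (σ≤2 P) L Φ
               (λ u v → cong₂ _∧_ (∧-comm (L u) (L v)) (Γ-sym P u v))
               (λ {u} {v} e → ∧⁻ˡ (∧⁻ˡ {L u ∧ L v} e))
               (λ {u} {v} e → Γ-σ P (∧⁻ʳ {L u ∧ L v} e))) ⟩
        suc b * count L ∎
      cancel : ∀ s → s * s ≤ suc b * s → s ≤ suc b
      cancel zero    _ = z≤n
      cancel (suc s) h = *-cancelʳ-≤ (suc s) (suc b) (suc s) h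

    2count-rich≤ : ∀ A → 2 * count (λ w → suc b <ᵇ deg A w) ≤ b * count A
    2count-rich≤ A with P , sat ← saturatedPairing A =
      ≤-trans (*-monoʳ-≤ 2 (count-mono rich⊆W)) (2count-W≤ P)
      where
      rich⊆W : ∀ w → (suc b <ᵇ deg A w) ≡ true → W P w ≡ true
      rich⊆W w e with W P w in ∈W
      ... | true  = refl
      ... | false = contradiction (<ᵇ⁻ e) (≤⇒≯ (unused⇒deg≤ P sat ∈W))

    -- Common neighbourhoods through vertices outside a set.

    common : (Fin n → Bool) → Fin n → Fin n → Bool
    common A v u = (A v ∧ A u) ∧ not ⌊ v Fin.≟ u ⌋ ∧
      anyB (λ w → not (A w) ∧ adj G u w ∧ adj G v w)

    -- When A is the set of unplaced vertices, `common A v` is what arrangeability will count at v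
    -- if v is placed next, since later witnesses are outside A. A pair joined through w is an edge
    -- of Γ by saturation if w is outside W. Otherwise it is one of at most D² ordered pairs of
    -- neighbours of w in A, and there are few such w.
    sum²-common≤ : ∀ A D → (∀ w → A w ≡ false → deg A w ≤ D) →
      sum² (λ v u → ⟦ common A v u ⟧) ≤ (b + b * (D * D)) * count A
    sum²-common≤ A D deg≤D with P , sat ← saturatedPairing A = begin
      sum² (λ v u → ⟦ common A v u ⟧)          ≤⟨ sum²-mono (λ v u → ⟦⟧≤ (pointwise v u)) ⟩
      sum² (λ v u → ⟦ Γ P v u ⟧ + sumF (λ w → X w * Y w v u))
                                               ≡⟨ sum²-+ {n} {n} _ _ ⟩
      sum² (λ v u → ⟦ Γ P v u ⟧) + sum² (λ v u → sumF (λ w → X w * Y w v u))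
        ≤⟨ +-mono-≤ (Γ≤ P) through ⟩
      b * count A + b * count A * (D * D)      ≡⟨ rearrange b (count A) (D * D) ⟩
      (b + b * (D * D)) * count A ∎
      where
      open ≤-Reasoning
      rearrange : ∀ b s d → b * s + b * s * d ≡ (b + b * d) * s
      rearrange = solve-∀
      -- The degree bound D is known outside A only, so members of W inside A are left out.
      X : Fin n → ℕ
      X w = ⟦ W P w ∧ not (A w) ⟧
      Y : Fin n → Fin n → Fin n → ℕ
      Y w v u = ⟦ link A w v ∧ link A w u ⟧
      pointwise : ∀ v u → common A v u ≡ true → 1 ≤ ⟦ Γ P v u ⟧ + sumF (λ w → X w * Y w v u)
      pointwise v u e with anyB⁻ (∧⁻ʳ {not ⌊ v Fin.≟ u ⌋} (∧⁻ʳ {A v ∧ A u} e))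
      ... | w , ew = go (W P w) refl
        where
        wv : link A w v ≡ true
        wv = ∧⁺ (∧⁻ˡ (∧⁻ˡ {A v ∧ A u} e))
          (≡.trans (sym G w v) (∧⁻ʳ {adj G u w} (∧⁻ʳ {not (A w)} ew)))
        wu : link A w u ≡ true
        wu = ∧⁺ (∧⁻ʳ {A v} (∧⁻ˡ {A v ∧ A u} e))
          (≡.trans (sym G w u) (∧⁻ˡ (∧⁻ʳ {not (A w)} ew)))
        v≢u : v ≢ u
        v≢u refl = true≢false
          (≡.trans (≡.sym (≟-refl v)) (not⁻ (∧⁻ˡ (∧⁻ʳ {A v ∧ A v} e))))
        go : ∀ x → W P w ≡ x → 1 ≤ ⟦ Γ P v u ⟧ + sumF (λ w → X w * Y w v u)
        go true  ∈W = ≤-trans (≤-trans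
          (*-mono-≤ (⟦true⟧ {W P w ∧ not (A w)} (∧⁺ ∈W (∧⁻ˡ ew))) (⟦true⟧ (∧⁺ wv wu)))
          (≤sum (λ w → X w * Y w v u) w)) (m≤n+m _ _)
        go false ∉W = ≤-trans (⟦true⟧ (sat w v u ∉W wv wu v≢u)) (m≤m+n _ _)
      perVertex : ∀ w → X w * (deg A w * deg A w) ≤ ⟦ W P w ⟧ * (D * D)
      perVertex w with W P w | A w in Aw
      ... | false | _     = z≤n
      ... | true  | true  = z≤n
      ... | true  | false = *-monoʳ-≤ 1 (*-mono-≤ (deg≤D w Aw) (deg≤D w Aw))
      through : sum² (λ v u → sumF (λ w → X w * Y w v u)) ≤ b * count A * (D * D)
      through = begin
        sum² (λ v u → sumF (λ w → X w * Y w v u))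
          ≡⟨ sum-cong {n} (λ v → sum-swap {n} {n} (λ u w → X w * Y w v u)) ⟩
        sum² (λ v w → sumF (λ u → X w * Y w v u))
          ≡⟨ sum-swap {n} {n} _ ⟩
        sum² (λ w v → sumF (λ u → X w * Y w v u))
          ≡⟨ sum-cong {n} (λ w → ≡.trans
               (sum-cong {n} (λ v → sum-*ˡ {n} (X w) (Y w v)))
               (≡.trans (sum-*ˡ {n} (X w) _) (cong (X w *_) (sum²-∧ (link A w) (link A w))))) ⟩
        sumF (λ w → X w * (deg A w * deg A w))   ≤⟨ sum-mono perVertex ⟩
        sumF (λ w → ⟦ W P w ⟧ * (D * D))         ≡⟨ sum-*ʳ {n} _ (D * D) ⟩
        sumF (λ w → ⟦ W P w ⟧) * (D * D)         ≡⟨ cong (_* (D * D)) (count≡sum (W P)) ⟨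
        count (W P) * (D * D)
          ≤⟨ *-monoˡ-≤ (D * D) (≤-trans (m≤m+n (count (W P)) _) (2count-W≤ P)) ⟩
        b * count A * (D * D) ∎

    -- Every vertex a put in a cover B raises its coverage, which is at most m|A|, by c; so |B| ≤ |A|/2b
    -- and at most |A|/4 vertices have m neighbours in B. A heavy vertex without m neighbours in B
    -- has 4c neighbours in A outside B, each adjacent to at most c such vertices: again at most
    -- |A|/4 of them.
    m c δ h : ℕ
    m = 2 + b
    c = 2 * b * m
    δ = maxBackDegree b
    h = meanCommon b

    -- At most half of a set has high degree into it.

    module _ (A : Fin n → Bool) where

      heavy : Fin n → Bool
      heavy w = A w ∧ (δ <ᵇ deg A w)

      poor : (Fin n → Bool) → Fin n → Bool
      poor B w = heavy w ∧ (deg B w <ᵇ m)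

      poorAt : (Fin n → Bool) → Fin n → Fin n → Bool
      poorAt B a w = poor B w ∧ adj G w a

      coverage : (Fin n → Bool) → ℕ
      coverage B = sumF (λ w → ⟦ heavy w ⟧ * (m ⊓ deg B w))

      coverage≤ : ∀ B → coverage B ≤ m * count A
      coverage≤ B = begin
        coverage B                    ≤⟨ sum-mono (λ w → *-mono-≤
                                           (⟦⟧≤ {x = ⟦ A w ⟧} (⟦true⟧ ∘ ∧⁻ˡ)) (m⊓n≤m m (deg B w))) ⟩
        sumF (λ w → ⟦ A w ⟧ * m)      ≡⟨ sum-*ʳ {n} _ m ⟩
        sumF (λ w → ⟦ A w ⟧) * m      ≡⟨ cong (_* m) (count≡sum A) ⟨
        count A * m                   ≡⟨ *-comm (count A) m ⟩
        m * count A ∎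
        where open ≤-Reasoning

      -- A poor neighbour of a has fewer than m neighbours in B, so its degree truncated at m still
      -- has room to rise by one; no other term falls.
      coverage-insert : ∀ B a → B a ≡ false →
        count (poorAt B a) + coverage B ≤ coverage (insert a B)
      coverage-insert B a a∉B = begin
        count (poorAt B a) + coverage B                   ≡⟨ cong (_+ coverage B) (count≡sum (poorAt B a)) ⟩
        sumF (λ w → ⟦ poorAt B a w ⟧) + coverage B        ≡⟨ sum-+ {n} _ _ ⟨
        sumF (λ w → ⟦ poorAt B a w ⟧ + ⟦ heavy w ⟧ * (m ⊓ deg B w))
                                                          ≤⟨ sum-mono pointwise ⟩
        coverage (insert a B) ∎
        where
        open ≤-Reasoning
        link⊆ : ∀ w u → link B w u ≡ true → link (insert a B) w u ≡ true
        link⊆ w u e = ∧⁺ (∨⁺ʳ {⌊ u Fin.≟ a ⌋} (∧⁻ˡ e)) (∧⁻ʳ {B u} e)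
        pointwise : ∀ w → ⟦ poorAt B a w ⟧ + ⟦ heavy w ⟧ * (m ⊓ deg B w) ≤
          ⟦ heavy w ⟧ * (m ⊓ deg (insert a B) w)
        pointwise w with poorAt B a w in e
        ... | false = *-monoʳ-≤ ⟦ heavy w ⟧ (⊓-monoʳ-≤ m (count-mono (link⊆ w)))
        ... | true with heavy w
        ... | true = begin
          suc (m ⊓ deg B w + 0)             ≡⟨ cong suc (+-identityʳ _) ⟩
          suc (m ⊓ deg B w)                 ≡⟨ cong suc (m≥n⇒m⊓n≡n (<⇒≤ lt)) ⟩
          suc (deg B w)                     ≤⟨ ⊓-glb lt (count-⊂ a {link B w} (link⊆ w)
                                                 (cong (_∧ adj G w a) a∉B)
                                                 (∧⁺ {insert a B a} (∨⁺ˡ (≟-refl a)) (∧⁻ʳ {deg B w <ᵇ m} e))) ⟩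
          m ⊓ deg (insert a B) w            ≡⟨ +-identityʳ _ ⟨
          m ⊓ deg (insert a B) w + 0 ∎
          where
          lt : deg B w < m
          lt = <ᵇ⁻ (∧⁻ˡ e)

      Cover : Set
      Cover = ∃ λ B → c * count B ≤ coverage B

      Maximal : Cover → Set
      Maximal (B , _) = ∀ a → A a ∧ not (B a) ≡ true → count (poorAt B a) ≤ c

      -- A vertex with more than c poor neighbours raises the coverage by more than c, hence can be
      -- added within the invariant of `Cover`. The coverage is bounded, so this stops.
      maximalCover : ∃ Maximal
      maximalCover = saturate (coverage ∘ proj₁) (m * count A) (coverage≤ ∘ proj₁) step
        ((λ _ → false) , ≤-trans (≤-reflexive (≡.trans (cong (c *_) (count-0 n)) (*-zeroʳ c))) z≤n)
        where
        step : ∀ B → Maximal B ⊎ ∃ λ B′ → coverage (proj₁ B) < coverage (proj₁ B′)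
        step (B , le) with Fin.any? (λ a → (A a ∧ not (B a) Bool.≟ true) ×-dec (c <? count (poorAt B a)))
        ... | no ∄ = inj₁ λ a ea → ≮⇒≥ λ lt → ∄ (a , ea , lt)
        ... | yes (a , ea , lt) = inj₂ ((insert a B , le′) ,
            ≤-trans (+-monoˡ-≤ (coverage B) (≤-trans (s≤s z≤n) lt)) grow)
          where
          open ≤-Reasoning
          a∉B : B a ≡ false
          a∉B = not⁻ (∧⁻ʳ {A a} ea)
          grow : count (poorAt B a) + coverage B ≤ coverage (insert a B)
          grow = coverage-insert B a a∉B
          le′ : c * count (insert a B) ≤ coverage (insert a B)
          le′ = begin
            c * count (insert a B)              ≡⟨ cong (c *_) (count-insert a B a∉B) ⟩
            c * suc (count B)                   ≡⟨ *-suc c (count B) ⟩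
            c + c * count B                     ≤⟨ +-mono-≤ (<⇒≤ lt) le ⟩
            count (poorAt B a) + coverage B     ≤⟨ grow ⟩
            coverage (insert a B) ∎

      2count-heavy≤ : 2 * count heavy ≤ count A
      2count-heavy≤ with (B , le) , max ← maximalCover = *-cancelˡ-≤ 2 (begin
        2 * (2 * count heavy)                         ≡⟨ *-assoc 2 2 (count heavy) ⟨
        4 * count heavy                               ≤⟨ *-monoʳ-≤ 4 split ⟩
        4 * (count rich + count (poor B))             ≡⟨ *-distribˡ-+ 4 (count rich) _ ⟩
        4 * count rich + 4 * count (poor B)           ≤⟨ +-mono-≤ 4rich 4poor ⟩
        count A + count A                             ≡⟨ cong (count A +_) (+-identityʳ _) ⟨
        2 * count A ∎)
        where
        open ≤-Reasoning
        rich : Fin n → Bool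
        rich w = suc b <ᵇ deg B w
        split : count heavy ≤ count rich + count (poor B)
        split = begin
          count heavy                                      ≡⟨ count≡sum heavy ⟩
          sumF (λ w → ⟦ heavy w ⟧)                         ≤⟨ sum-mono (λ w → ⟦⟧≤ (richOrPoor w)) ⟩
          sumF (λ w → ⟦ rich w ⟧ + ⟦ poor B w ⟧)           ≡⟨ sum-+ {n} _ _ ⟩
          sumF (λ w → ⟦ rich w ⟧) + sumF (λ w → ⟦ poor B w ⟧)
            ≡⟨ cong₂ _+_ (count≡sum rich) (count≡sum (poor B)) ⟨
          count rich + count (poor B) ∎
          where
          richOrPoor : ∀ w → heavy w ≡ true → 1 ≤ ⟦ rich w ⟧ + ⟦ poor B w ⟧
          richOrPoor w h with deg B w <? m
          ... | yes lt = ≤-trans (⟦true⟧ {poor B w} (∧⁺ h (<ᵇ⁺ lt))) (m≤n+m _ ⟦ rich w ⟧)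
          -- As m = b + 2, having at least m neighbours in B is exactly exceeding the threshold b +
          -- 1 of `rich`.
          ... | no ≮   = ≤-trans (⟦true⟧ {rich w} (<ᵇ⁺ (≮⇒≥ ≮))) (m≤m+n _ _)
        4rich : 4 * count rich ≤ count A
        4rich = begin
          4 * count rich           ≡⟨ *-assoc 2 2 (count rich) ⟩
          2 * (2 * count rich)     ≤⟨ *-monoʳ-≤ 2 (2count-rich≤ B) ⟩
          2 * (b * count B)        ≡⟨ *-assoc 2 b (count B) ⟨
          2 * b * count B          ≤⟨ *-cancelʳ-≤ (2 * b * count B) (count A) m scaled ⟩
          count A ∎
          where
          -- The two bounds on the coverage give c|B| ≤ m|A|; as c = 2bm, cancelling m leaves 2b|B|
          -- ≤ |A|.
          scaled : 2 * b * count B * m ≤ count A * m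
          scaled = begin
            2 * b * count B * m    ≡⟨ rearrange (2 * b) (count B) m ⟩
            c * count B            ≤⟨ ≤-trans le (coverage≤ B) ⟩
            m * count A            ≡⟨ *-comm m (count A) ⟩
            count A * m ∎
            where
            rearrange : ∀ x y z → x * y * z ≡ x * z * y
            rearrange = solve-∀
        rest : Fin n → Bool
        rest a = A a ∧ not (B a)
        poor⇒4c≤ : ∀ w → poor B w ≡ true → 4 * c ≤ deg rest w
        -- As δ = m + 4c, a heavy vertex with fewer than m neighbours in B keeps 4c neighbours in
        -- the rest of A.
        poor⇒4c≤ w e = +-cancelˡ-≤ m (4 * c) (deg rest w) (begin
          δ                        ≤⟨ <⇒≤ (<ᵇ⁻ {δ} (∧⁻ʳ {A w} (∧⁻ˡ {heavy w} e))) ⟩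
          deg A w                  ≡⟨ count≡sum (link A w) ⟩
          sumF (λ u → ⟦ link A w u ⟧)
            ≤⟨ sum-mono (λ u → ⟦⟧≤ (inOrOut u)) ⟩
          sumF (λ u → ⟦ link B w u ⟧ + ⟦ link rest w u ⟧)
            ≡⟨ sum-+ {n} _ _ ⟩
          sumF (λ u → ⟦ link B w u ⟧) + sumF (λ u → ⟦ link rest w u ⟧)
            ≡⟨ cong₂ _+_ (count≡sum (link B w)) (count≡sum (link rest w)) ⟨
          deg B w + deg rest w     ≤⟨ +-monoˡ-≤ (deg rest w) (<⇒≤ (<ᵇ⁻ (∧⁻ʳ {heavy w} e))) ⟩
          m + deg rest w ∎)
          where
          inOrOut : ∀ u → link A w u ≡ true → 1 ≤ ⟦ link B w u ⟧ + ⟦ link rest w u ⟧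
          inOrOut u e with B u | A u | adj G w u
          ... | true  | true | true = s≤s z≤n
          ... | false | true | true = s≤s z≤n
        -- Maximality of the cover bounds the poor neighbours of each vertex of A outside B, and
        -- other vertices contribute nothing. Weighting by A instead of `rest` makes the total c|A|.
        perVertex : ∀ a → sumF (λ w → ⟦ poor B w ⟧ * ⟦ link rest w a ⟧) ≤ ⟦ A a ⟧ * c
        perVertex a with rest a in ra
        ... | false = ≤-trans (≤-reflexive (≡.trans (sum-cong {n} (λ w → *-zeroʳ ⟦ poor B w ⟧)) (sum-0 n))) z≤n
        ... | true  = ≤-trans (≤-reflexive (≡.sym (≡.trans (count≡sum (poorAt B a))
            (sum-cong {n} (λ w → ⟦∧⟧ (poor B w) (adj G w a))))))
          (≤-trans (max a ra) (≤-trans (≤-reflexive (≡.sym (+-identityʳ c)))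
            (*-monoˡ-≤ c (⟦true⟧ {A a} (∧⁻ˡ ra)))))
        4poor : 4 * count (poor B) ≤ count A
        4poor = *-cancelʳ-≤ (4 * count (poor B)) (count A) c (begin
          4 * count (poor B) * c                               ≡⟨ rearrange (count (poor B)) c ⟩
          count (poor B) * (4 * c)                             ≡⟨ cong (_* (4 * c)) (count≡sum (poor B)) ⟩
          sumF (λ w → ⟦ poor B w ⟧) * (4 * c)                  ≡⟨ sum-*ʳ {n} _ (4 * c) ⟨
          sumF (λ w → ⟦ poor B w ⟧ * (4 * c))                  ≤⟨ sum-mono pointwise ⟩
          sum² (λ w a → ⟦ poor B w ⟧ * ⟦ link rest w a ⟧)      ≡⟨ sum-swap {n} {n} _ ⟩
          sum² (λ a w → ⟦ poor B w ⟧ * ⟦ link rest w a ⟧)      ≤⟨ sum-mono perVertex ⟩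
          sumF (λ a → ⟦ A a ⟧ * c)                             ≡⟨ sum-*ʳ {n} _ c ⟩
          sumF (λ a → ⟦ A a ⟧) * c                             ≡⟨ cong (_* c) (count≡sum A) ⟨
          count A * c ∎)
          where
          rearrange : ∀ p c → 4 * p * c ≡ p * (4 * c)
          rearrange = solve-∀
          pointwise : ∀ w → ⟦ poor B w ⟧ * (4 * c) ≤ sumF (λ a → ⟦ poor B w ⟧ * ⟦ link rest w a ⟧)
          pointwise w with poor B w in e
          ... | false = z≤n
          ... | true  = ≤-trans (*-monoʳ-≤ 1 (poor⇒4c≤ w e)) (≤-reflexive
            (≡.trans (cong (1 *_) (count≡sum (link rest w))) (≡.sym (sum-*ˡ {n} 1 _))))


    -- By averaging. If no vertex works, each vertex of A is heavy or has at least K = 2h + 1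
    -- partners in `common A`, so K|A| ≤ K|heavy| + h|A|. As at most half of A is heavy, K|A| ≤
    -- 2h|A|, which is false for nonempty A.
    lastVertex : ∀ A → 0 < count A → (∀ w → A w ≡ false → deg A w ≤ δ) →
      ∃ λ v → A v ≡ true × deg A v ≤ δ × count (common A v) ≤ 2 * h
    lastVertex A pos outside
      with Fin.any? (λ v → (A v Bool.≟ true) ×-dec (deg A v ≤? δ) ×-dec (count (common A v) ≤? 2 * h))
    ... | yes found = found
    ... | no ∄ = contradiction pos (≤⇒≯ (+-cancelʳ-≤ (2 * h * count A) (count A) 0 (begin
      count A + 2 * h * count A                                      ≡⟨ double (count A) h ⟩
      K * count A                                                    ≤⟨ +-cancelˡ-≤ (K * count A) _ _ doubled ⟩
      2 * (h * count A)                                              ≡⟨ *-assoc 2 h (count A) ⟨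
      2 * h * count A ∎)))
      where
      open ≤-Reasoning
      K : ℕ
      K = suc (2 * h)
      double : ∀ s h → s + 2 * h * s ≡ suc (2 * h) * s
      double = solve-∀
      pointwise : ∀ v → K * ⟦ A v ⟧ ≤ K * ⟦ heavy A v ⟧ + count (common A v)
      pointwise v = go (A v) refl
        where
        go : ∀ a → A v ≡ a → K * ⟦ a ⟧ ≤ K * ⟦ heavy A v ⟧ + count (common A v)
        go false _ = ≤-trans (≤-reflexive (*-zeroʳ K)) z≤n
        go true Av with deg A v ≤? δ
        ... | no ≰  = ≤-trans (*-monoʳ-≤ K (⟦true⟧ {heavy A v} (∧⁺ Av (<ᵇ⁺ (≰⇒> ≰))))) (m≤m+n _ _)
        ... | yes ≤δ = ≤-trans (≤-trans (≤-reflexive (*-identityʳ K))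
          (≰⇒> λ le → ∄ (v , Av , ≤δ , le))) (m≤n+m _ _)
      weighted : K * count A ≤ K * count (heavy A) + h * count A
      weighted = begin
        K * count A                           ≡⟨ cong (K *_) (count≡sum A) ⟩
        K * sumF (λ v → ⟦ A v ⟧)              ≡⟨ sum-*ˡ {n} K _ ⟨
        sumF (λ v → K * ⟦ A v ⟧)              ≤⟨ sum-mono pointwise ⟩
        sumF (λ v → K * ⟦ heavy A v ⟧ + count (common A v))
                                              ≡⟨ sum-+ {n} _ _ ⟩
        sumF (λ v → K * ⟦ heavy A v ⟧) + sumF (λ v → count (common A v))
          ≤⟨ +-mono-≤
               (≤-reflexive (≡.trans (sum-*ˡ {n} K _) (cong (K *_) (≡.sym (count≡sum (heavy A))))))
               (≤-trans (≤-reflexive (sum-cong {n} (λ v → count≡sum (common A v))))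
                 (sum²-common≤ A δ outside)) ⟩
        K * count (heavy A) + h * count A ∎
      -- Doubling allows 2|heavy| ≤ |A| to be used without division.
      doubled : K * count A + K * count A ≤ K * count A + 2 * (h * count A)
      doubled = begin
        K * count A + K * count A                       ≡⟨ cong (K * count A +_) (+-identityʳ _) ⟨
        2 * (K * count A)                               ≤⟨ *-monoʳ-≤ 2 weighted ⟩
        2 * (K * count (heavy A) + h * count A)         ≡⟨ distribute K (count (heavy A)) (h * count A) ⟩
        K * (2 * count (heavy A)) + 2 * (h * count A)
          ≤⟨ +-monoˡ-≤ _ (*-monoʳ-≤ K (2count-heavy≤ A)) ⟩
        K * count A + 2 * (h * count A) ∎
        where
        distribute : ∀ K t x → 2 * (K * t + x) ≡ K * (2 * t) + 2 * x
        distribute = solve-∀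

    -- Building the ordering from its end.

    precedes : (Fin n → ℕ) → Fin n → Fin n → Bool
    precedes r v u = (r u <ᵇ r v) ∧ anyB (λ w → adj G u w ∧ adj G v w ∧ (r v <ᵇ r w))

    -- Rank 0 marks the vertices not yet placed. All of them come before every ranked vertex, so
    -- `precedes` already has its final value at a ranked vertex while the order among the rest is
    -- open.
    unranked : (Fin n → ℕ) → Fin n → Bool
    unranked r v = r v <ᵇ 1

    -- The last n ∸ j vertices of the ordering have been chosen: they carry the ranks
    -- j + 1, …, n, and the other vertices have rank 0.
    record Tail (j : ℕ) : Set where
      field
        r          : Fin n → ℕ
        remaining  : count (unranked r) ≡ j
        j<r        : ∀ {v} → 0 < r v → j < r v
        r≤n        : ∀ v → r v ≤ n
        r-inj      : ∀ {u v} → 0 < r u → r u ≡ r v → u ≡ v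
        deg≤δ      : ∀ {w} → 0 < r w → deg (unranked r) w ≤ δ
        precedes≤  : ∀ {v} → 0 < r v → count (precedes r v) ≤ 2 * h

    unranked⁻ : ∀ r {v} → unranked r v ≡ false → 0 < r v
    unranked⁻ r {v} e with r v
    ... | suc _ = s≤s z≤n

    unranked⁺ : ∀ r {v} → 0 < r v → unranked r v ≡ false
    unranked⁺ r {v} pos with r v
    ... | suc _ = refl

    unranked-0 : ∀ r {v} → unranked r v ≡ true → r v ≡ 0
    unranked-0 r {v} e with r v
    ... | zero = refl

    -- The new vertex v gets rank j + 1, below all ranks in use. Hence an older ranked vertex still
    -- has v before it and cannot get v as a witness, so its count does not grow. At v itself the
    -- earlier vertices are unranked and the witnesses are ranked, so `common` bounds the count.
    prepend : ∀ {j} → Tail (suc j) → Tail j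
    prepend {j} t with lastVertex (unranked (Tail.r t))
        (≤-trans (s≤s z≤n) (≤-reflexive (≡.sym (Tail.remaining t))))
        (λ w e → Tail.deg≤δ t (unranked⁻ (Tail.r t) e))
    ... | v , v∈ , deg-v , common-v = record
      { r = r′ ; remaining = suc-injective (≡.trans size (remaining t)) ; j<r = λ {u} → j<r′ u
      ; r≤n = r′≤n ; r-inj = λ {u} {w} → r′-inj u w
      ; deg≤δ = λ {w} → deg′ w ; precedes≤ = λ {u} → precedes′ u }
      where
      open Tail
      open ≤-Reasoning
      r₀ r′ : Fin n → ℕ
      r₀ = r t
      r′ u = if ⌊ u Fin.≟ v ⌋ then suc j else r₀ u
      r₀v : r₀ v ≡ 0
      r₀v = unranked-0 r₀ v∈
      r′v : r′ v ≡ suc j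
      r′v rewrite ≟-refl v = refl
      r′-other : ∀ {u} → u ≢ v → r′ u ≡ r₀ u
      r′-other u≢v rewrite ≢⇒≟ u≢v = refl
      unranked-r′ : ∀ {u} → unranked r′ u ≡ true → unranked r₀ u ≡ true
      unranked-r′ {u} e with u Fin.≟ v
      ... | no _ = e
      size : suc (count (unranked r′)) ≡ count (unranked r₀)
      size = ≡.trans
        (≡.sym (count-insert v (unranked r′) (unranked⁺ r′ (≤-trans (s≤s z≤n) (≤-reflexive (≡.sym r′v))))))
        (count-cong same)
        where
        same : ∀ u → insert v (unranked r′) u ≡ unranked r₀ u
        same u with u Fin.≟ v
        ... | yes refl = ≡.sym v∈
        ... | no _     = refl
      j<r′ : ∀ u → 0 < r′ u → j < r′ u
      j<r′ u pos with u Fin.≟ v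
      ... | yes _ = ≤-refl
      ... | no _  = <⇒≤ (j<r t pos)
      r′≤n : ∀ u → r′ u ≤ n
      r′≤n u with u Fin.≟ v
      -- The new rank j + 1 is the number of unranked vertices, hence at most n.
      ... | yes _ = ≤-trans (≤-reflexive (≡.sym (remaining t))) (count≤n (unranked r₀))
      ... | no _  = r≤n t u
      r′-inj : ∀ u w → 0 < r′ u → r′ u ≡ r′ w → u ≡ w
      r′-inj u w pos eq with u Fin.≟ v | w Fin.≟ v
      ... | yes refl | yes refl = refl
      ... | yes refl | no _ = contradiction (j<r t (≤-trans pos (≤-reflexive eq)))
        (≤⇒≯ (≤-reflexive (≡.sym eq)))
      ... | no _ | yes refl = contradiction (j<r t pos) (≤⇒≯ (≤-reflexive eq))
      ... | no _ | no _ = r-inj t pos eq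
      -- The unranked set only shrinks, so degrees into it never grow after a vertex is placed.
      deg′ : ∀ w → 0 < r′ w → deg (unranked r′) w ≤ δ
      deg′ w pos = ≤-trans
        (count-mono {p = link (unranked r′) w} {link (unranked r₀) w}
          (λ u e → ∧⁺ (unranked-r′ {u} (∧⁻ˡ e)) (∧⁻ʳ {unranked r′ u} e)))
        old
        where
        old : deg (unranked r₀) w ≤ δ
        old with w Fin.≟ v
        ... | yes refl = deg-v
        ... | no _     = deg≤δ t pos
      precedes⁻ : ∀ {u x} → precedes r′ x u ≡ true → r′ u < r′ x ×
        ∃ λ w → adj G u w ≡ true × adj G x w ≡ true × r′ x < r′ w
      precedes⁻ {u} {x} e =
        let w , ew = anyB⁻ (∧⁻ʳ {r′ u <ᵇ r′ x} e) in
        <ᵇ⁻ (∧⁻ˡ e) , w , ∧⁻ˡ ew , ∧⁻ˡ (∧⁻ʳ {adj G u w} ew) ,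
        <ᵇ⁻ (∧⁻ʳ {adj G x w} (∧⁻ʳ {adj G u w} ew))
      precedes-new : ∀ u → precedes r′ v u ≡ true → common (unranked r₀) v u ≡ true
      precedes-new u e with lt , w , uw , vw , gt ← precedes⁻ {u} {v} e =
        ∧⁺ (∧⁺ v∈ u∈) (∧⁺ (not⁺ (≢⇒≟ (u≢v ∘ ≡.sym)))
          (anyB⁺ {p = λ w → not (unranked r₀ w) ∧ adj G u w ∧ adj G v w} w
            (∧⁺ (not⁺ (unranked⁺ r₀ r₀w)) (∧⁺ uw vw))))
        where
        u≢v : u ≢ v
        u≢v refl = <-irrefl refl lt
        w≢v : w ≢ v
        w≢v refl = <-irrefl refl gt
        r₀w : 0 < r₀ w
        r₀w = ≤-trans (s≤s z≤n) (≤-trans gt (≤-reflexive (r′-other w≢v)))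
        u∈ : unranked r₀ u ≡ true
        u∈ with unranked r₀ u in eq
        ... | true  = refl
        ... | false = contradiction (j<r t (unranked⁻ r₀ eq))
          (<-asym (≡.subst₂ _<_ (r′-other u≢v) r′v lt))
      precedes-old : ∀ {x} → x ≢ v → 0 < r₀ x → ∀ u → precedes r′ x u ≡ true → precedes r₀ x u ≡ true
      precedes-old {x} x≢v pos u e with lt , w , uw , xw , gt ← precedes⁻ {u} {x} e =
        ∧⁺ (<ᵇ⁺ before) (anyB⁺ {p = λ w → adj G u w ∧ adj G x w ∧ (r₀ x <ᵇ r₀ w)} w
          (∧⁺ uw (∧⁺ xw (<ᵇ⁺ after))))
        where
        before : r₀ u < r₀ x
        before with u Fin.≟ v
        ... | yes refl = ≤-trans (s≤s (≤-reflexive r₀v)) pos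
        ... | no _     = ≤-trans lt (≤-reflexive (r′-other x≢v))
        after : r₀ x < r₀ w
        after with w Fin.≟ v
        ... | yes refl = contradiction (j<r t pos) (<-asym (≤-trans (s≤s (≤-reflexive (≡.sym (r′-other x≢v)))) gt))
        ... | no _     = ≤-trans (s≤s (≤-reflexive (≡.sym (r′-other x≢v)))) gt
      precedes′ : ∀ x → 0 < r′ x → count (precedes r′ x) ≤ 2 * h
      precedes′ x pos = go (x Fin.≟ v)
        where
        go : Dec (x ≡ v) → count (precedes r′ x) ≤ 2 * h
        go (yes refl) = ≤-trans (count-mono {p = precedes r′ v} precedes-new) common-v
        go (no x≢v)   = ≤-trans (count-mono {p = precedes r′ x} (precedes-old x≢v r₀x)) (precedes≤ t r₀x)
          where
          r₀x : 0 < r₀ x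
          r₀x = ≡.subst (0 <_) (r′-other x≢v) pos

    complete : ∀ {j} → Tail j → Tail 0
    complete {zero}  t = t
    complete {suc j} t = complete (prepend t)

    fullTail : Tail 0
    -- Starting from a `count` instead of n lets `remaining` hold by computation.
    fullTail = complete {count {n} (λ _ → true)} (record
      { r = λ _ → 0 ; remaining = refl ; j<r = λ () ; r≤n = λ _ → z≤n ; r-inj = λ ()
      ; deg≤δ = λ () ; precedes≤ = λ () })

    -- In a full tail all ranks are distinct and lie between 1 and n. Lowering them by one gives an
    -- injection into `Fin n`, hence a permutation, and keeps every comparison.
    arrangeable : arrAtMost G (2 * h)
    arrangeable = π , λ v → ≤-trans (count-mono {q = precedes r v} (transfer v)) (precedes≤ (r>0 v))
      where
      open Tail fullTail
      r>0 : ∀ v → 0 < r v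
      r>0 v with unranked r v in e
      ... | false = unranked⁻ r e
      -- An unranked vertex would make the number of remaining vertices positive.
      ... | true  = contradiction remaining (λ eq → <-irrefl refl (begin-strict
        0                            <⟨ ⟦true⟧ e ⟩
        ⟦ unranked r v ⟧             ≤⟨ ≤sum (λ v → ⟦ unranked r v ⟧) v ⟩
        sumF (λ v → ⟦ unranked r v ⟧) ≡⟨ count≡sum (unranked r) ⟨
        count (unranked r)           ≡⟨ eq ⟩
        0 ∎))
        where open ≤-Reasoning
      suc-pred-r : ∀ v → suc (pred (r v)) ≡ r v
      suc-pred-r v with r v | r>0 v
      ... | suc _ | _ = refl
      pred-r<n : ∀ v → pred (r v) < n
      pred-r<n v = ≤-trans (≤-reflexive (suc-pred-r v)) (r≤n v)
      f : Fin n → Fin n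
      f v = Fin.fromℕ< (pred-r<n v)
      suc-f : ∀ v → suc (Fin.toℕ (f v)) ≡ r v
      suc-f v = ≡.trans (cong suc (Fin.toℕ-fromℕ< (pred-r<n v))) (suc-pred-r v)
      f-injective : ∀ {u v} → f u ≡ f v → u ≡ v
      f-injective {u} {v} eq = r-inj (r>0 u)
        (≡.trans (≡.sym (suc-f u)) (≡.trans (cong (suc ∘ Fin.toℕ) eq) (suc-f v)))
      π : Permutation′ n
      π = injective⇒permutation f f-injective
      transfer : ∀ v u → (Fin.toℕ (f u) <ᵇ Fin.toℕ (f v)) ∧
        anyB (λ w → adj G u w ∧ adj G v w ∧ (Fin.toℕ (f v) <ᵇ Fin.toℕ (f w))) ≡ true →
        precedes r v u ≡ true
      transfer v u e with w , ew ← anyB⁻ (∧⁻ʳ {Fin.toℕ (f u) <ᵇ Fin.toℕ (f v)} e) =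
        ∧⁺ (<-r (∧⁻ˡ e)) (anyB⁺ {p = λ w → adj G u w ∧ adj G v w ∧ (r v <ᵇ r w)} w
          (∧⁺ (∧⁻ˡ {adj G u w} ew) (∧⁺ (∧⁻ˡ {adj G v w} (∧⁻ʳ {adj G u w} ew))
            (<-r (∧⁻ʳ {adj G v w} (∧⁻ʳ {adj G u w} ew))))))
        where
        <-r : ∀ {x y} → (Fin.toℕ (f x) <ᵇ Fin.toℕ (f y)) ≡ true → (r x <ᵇ r y) ≡ true
        <-r {x} {y} e = <ᵇ⁺ (≡.subst₂ _<_ (suc-f x) (suc-f y) (s≤s (<ᵇ⁻ e)))


-- Passing between natural and rational bounds.

open import Data.Integer as ℤ using (+_; -[1+_])
import Data.Integer.Properties as ℤ
open import Data.Nat as ℕ using (ℕ; suc)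
import Data.Nat.Coprimality as ℕ
import Data.Nat.Properties as ℕ
open import Data.Product using (_,_; proj₁; proj₂)
open import Data.Fin.Subset using (∣_∣)
open import Data.Rational using (ℚ; mkℚ; *≤*; ↥_; _/_; NonNegative; nonNegative; _≤_; _*_)
import Data.Rational.Properties as ℚ
open import Function.Bundles using (_⇔_; mk⇔)
open import Relation.Binary.PropositionalEquality as ≡ using (cong; cong₂; subst₂)

-- `toℚ` normalises by a gcd; over denominator 1 the fraction is already reduced, and the explicit
-- form lets order and product compute on numerators.
toℚ≡mkℚ : ∀ m → toℚ m ≡ mkℚ (+ m) 0 (ℕ.sym (ℕ.1-coprimeTo m))
toℚ≡mkℚ m = ℚ.normalize-coprime (ℕ.sym (ℕ.1-coprimeTo m))

toℚ-* : ∀ m n → toℚ (m ℕ.* n) ≡ toℚ m * toℚ n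
toℚ-* m n rewrite toℚ≡mkℚ m | toℚ≡mkℚ n = cong (_/ 1) (ℤ.pos-* m n)

toℚ-mono : ∀ {m n} → m ℕ.≤ n → toℚ m ≤ toℚ n
toℚ-mono {m} {n} m≤n rewrite toℚ≡mkℚ m | toℚ≡mkℚ n =
  *≤* (ℤ.*-monoʳ-≤-nonNeg (+ 1) (ℤ.+≤+ m≤n))

toℚ-cancel : ∀ {m n} → toℚ m ≤ toℚ n → m ℕ.≤ n
toℚ-cancel {m} {n} le rewrite toℚ≡mkℚ m | toℚ≡mkℚ n =
  ℤ.drop‿+≤+ (ℤ.*-cancelʳ-≤-pos (+ m) (+ n) (+ 1) (ℚ.drop-*≤* le))

toℚ-nonNeg : ∀ m → NonNegative (toℚ m)
toℚ-nonNeg m = nonNegative (toℚ-mono {0} {m} ℕ.z≤n)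

-- Dividing a nonnegative numerator by a denominator of at least 1 does not increase it, and a
-- negative fraction is below every natural number. The successor gives the positive bound that
-- `Sparse` works with.
≤toℚ : ∀ x → x ≤ toℚ (suc ℤ.∣ ↥ x ∣)
≤toℚ x@(mkℚ (+ a) d _) rewrite toℚ≡mkℚ (suc a) =
  *≤* (subst₂ ℤ._≤_ (ℤ.pos-* a 1) (ℤ.pos-* (suc a) (suc d))
    (ℤ.+≤+ (ℕ.*-mono-≤ (ℕ.n≤1+n a) (ℕ.s≤s ℕ.z≤n))))
≤toℚ x@(mkℚ -[1+ a ] d _) rewrite toℚ≡mkℚ (suc (suc a)) = *≤* ℤ.-≤+

open Combinatorics using (meanCommon; module Arranged; module Sparse)

-- The four statements and the cycle of implications.

LinearMad FunctionMad PairMad BoundedArr : GraphClass → Set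
LinearMad 𝓕 = Σ ℚ λ C → ∀ {n} (G : Graph n) → 𝓕 G → (Sg : NeighborhoodSystem G) →
  madAtMost Sg (C * toℚ (ρ Sg))
FunctionMad 𝓕 = Σ (ℕ → ℚ) λ f → ∀ {n} (G : Graph n) → 𝓕 G → (Sg : NeighborhoodSystem G) →
  madAtMost Sg (f (ρ Sg))
PairMad 𝓕 = Σ ℚ λ B → ∀ {n} (G : Graph n) → 𝓕 G → (Sg : NeighborhoodSystem G) → ρ Sg ≡ 2 →
  madAtMost Sg B
BoundedArr 𝓕 = Σ ℕ λ k → ∀ {n} (G : Graph n) → 𝓕 G → arrAtMost G k

linear⇒function : (𝓕 : GraphClass) → LinearMad 𝓕 → FunctionMad 𝓕
linear⇒function 𝓕 (C , mad≤) = (λ r → C * toℚ r) , mad≤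

function⇒pair : (𝓕 : GraphClass) → FunctionMad 𝓕 → PairMad 𝓕
function⇒pair 𝓕 (f , mad≤) = f 2 , λ G G∈𝓕 Sg ρ≡2 →
  ≡.subst (λ r → madAtMost Sg (f r)) ρ≡2 (mad≤ G G∈𝓕 Sg)

pair⇒arr : (𝓕 : GraphClass) → PairMad 𝓕 → BoundedArr 𝓕
pair⇒arr 𝓕 (B , mad≤) = 2 ℕ.* meanCommon b , λ G G∈𝓕 → Sparse.arrangeable G ℤ.∣ ↥ B ∣ (sparse G G∈𝓕)
  where
  b : ℕ
  -- A bound B that may be fractional or negative is replaced by a positive natural number above it.
  b = suc ℤ.∣ ↥ B ∣
  open ℚ.≤-Reasoning
  sparse : ∀ {n} (G : Graph n) → 𝓕 G → (Sg : NeighborhoodSystem G) → ρ Sg ≡ 2 →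
    (H : Subgraph Sg) → 2 ℕ.* edgeCount (F H) ℕ.≤ b ℕ.* ∣ S H ∣
  sparse G G∈𝓕 Sg ρ≡2 H = toℚ-cancel (begin
    toℚ (2 ℕ.* edgeCount (F H))  ≤⟨ mad≤ G G∈𝓕 Sg ρ≡2 H ⟩
    B * toℚ ∣ S H ∣
      ≤⟨ ℚ.*-monoʳ-≤-nonNeg (toℚ ∣ S H ∣) {{toℚ-nonNeg ∣ S H ∣}} (≤toℚ B) ⟩
    toℚ b * toℚ ∣ S H ∣          ≡⟨ toℚ-* b ∣ S H ∣ ⟨
    toℚ (b ℕ.* ∣ S H ∣) ∎)

arr⇒linear : (𝓕 : GraphClass) → BoundedArr 𝓕 → LinearMad 𝓕
arr⇒linear 𝓕 (k , arr) = toℚ c , mad≤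
  where
  c : ℕ
  -- At each vertex, k for the close vertices and k + 1 for the earlier neighbours; the factor 2
  -- comes from the average degree.
  c = 2 ℕ.* (k ℕ.+ suc k)
  open ℚ.≤-Reasoning
  mad≤ : ∀ {n} (G : Graph n) → 𝓕 G → (Sg : NeighborhoodSystem G) → madAtMost Sg (toℚ c * toℚ (ρ Sg))
  mad≤ G G∈𝓕 Sg H with π , close≤ ← arr G G∈𝓕 = begin
    toℚ (2 ℕ.* edgeCount (F H))         ≤⟨ toℚ-mono (Arranged.edges≤ G k π close≤ Sg H) ⟩
    toℚ (c ℕ.* ρ Sg ℕ.* ∣ S H ∣)        ≡⟨ toℚ-* (c ℕ.* ρ Sg) ∣ S H ∣ ⟩
    toℚ (c ℕ.* ρ Sg) * toℚ ∣ S H ∣      ≡⟨ cong (_* toℚ ∣ S H ∣) (toℚ-* c (ρ Sg)) ⟩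
    toℚ c * toℚ (ρ Sg) * toℚ ∣ S H ∣ ∎

theorem7 : (𝓕 : GraphClass) →
    let I   = Σ ℚ λ C → ∀ {n} (G : Graph n) → 𝓕 G → (Sg : NeighborhoodSystem G) → madAtMost Sg (C * toℚ (ρ Sg))
        II  = Σ (ℕ → ℚ) λ f → ∀ {n} (G : Graph n) → 𝓕 G → (Sg : NeighborhoodSystem G) → madAtMost Sg (f (ρ Sg))
        III = Σ ℚ λ B → ∀ {n} (G : Graph n) → 𝓕 G → (Sg : NeighborhoodSystem G) → ρ Sg ≡ 2 → madAtMost Sg B
        IV  = Σ ℕ λ k → ∀ {n} (G : Graph n) → 𝓕 G → arrAtMost G k
    in (I ⇔ II) × (II ⇔ III) × (III ⇔ IV)
theorem7 𝓕 =
  -- Each converse runs through the rest of the cycle.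
  mk⇔ I⇒II (λ ii → IV⇒I (III⇒IV (II⇒III ii))) ,
  mk⇔ II⇒III (λ iii → I⇒II (IV⇒I (III⇒IV iii))) ,
  mk⇔ III⇒IV (λ iv → II⇒III (I⇒II (IV⇒I iv)))
  where
  I⇒II   = linear⇒function 𝓕
  II⇒III = function⇒pair 𝓕
  III⇒IV = pair⇒arr 𝓕
  IV⇒I   = arr⇒linear 𝓕
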